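{- Let $\beta\in S_n$ have cycle type $(c_1,\dots,c_n)$. Then the number $c(3,\beta)$ of $\alpha\in S_n$ with $H(\alpha\beta,\beta\alpha)=3$ equals \[ c(3,\beta)=\Big(\sum_{\ell=3}^{n}c_\ell\binom{\ell}{3}+\sum_{1\le\ell<m\le n}\ell m\,c_\ell c_m\Big)|C_{S_n}(\beta)|. \]
   Context: $S_n$ is the symmetric group on $[n]$, products composed right to left; $H(\sigma,\tau)=|\{a:\sigma(a)\ne\tau(a)\}|$ is the Hamming metric. The cycle type $(c_1,\dots,c_n)$ means $\beta$ has exactly $c_i$ cycles of length $i$ (fixed points counted as $1$-cycles). $C_{S_n}(\beta)$ is the centralizer of $\beta$, of order $\prod_i i^{c_i}c_i!$. -}

module Defs where

open import Data.Nat using (ℕ; zero; suc; _+_; _*_; _∸_; _≡ᵇ_; _<ᵇ_)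
open import Data.Nat.Combinatorics using (_C_)
open import Data.Bool using (Bool; true; false; _∧_; _∨_; not; T)
open import Data.Fin using (Fin; toℕ; _≟_; _≤?_)
open import Data.Vec using (Vec; []; _∷_; lookup; tabulate; allFin)
import Data.Vec as Vec
open import Data.List using (List; []; _∷_; _++_; map; concatMap; filter; length; upTo)
open import Data.Nat.ListAction using () renaming (sum to lsum)
open import Relation.Nullary.Decidable using (⌊_⌋)

-- A map [n] → [n] is represented by its table of values (a vector);
-- σ(a) = lookup σ a.  Elements of S_n are the tables that are permutations.
Map : ℕ → Set
Map n = Vec (Fin n) n

_==_ : ∀ {n} → Fin n → Fin n → Bool
a == b = ⌊ a ≟ b ⌋

allF : ∀ {n} → (Fin n → Bool) → Bool
allF p = Vec.foldr _ (λ x acc → x ∧ acc) true (tabulate p)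

anyF : ∀ {n} → (Fin n → Bool) → Bool
anyF p = Vec.foldr _ (λ x acc → x ∨ acc) false (tabulate p)

countF : ∀ {n} → (Fin n → Bool) → ℕ
countF p = Vec.foldr _ (λ x acc → (if x then 1 else 0) + acc) 0 (tabulate p)
  where open import Data.Bool using (if_then_else_)

-- σ is a bijection of [n] (injective, hence bijective on a finite set)
isPerm : ∀ {n} → Map n → Bool
isPerm {n} σ = allF λ a → allF λ b → (a == b) ∨ not (lookup σ a == lookup σ b)

_∘ₚ_ : ∀ {n} → Map n → Map n → Map n
σ ∘ₚ τ = tabulate λ a → lookup σ (lookup τ a)

H : ∀ {n} → Map n → Map n → ℕ
H σ τ = countF λ a → not (lookup σ a == lookup τ a)

allVecs : (n k : ℕ) → List (Vec (Fin n) k)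
allVecs n zero = [] ∷ []
allVecs n (suc k) = concatMap (λ v → map (λ x → x ∷ v) (Data.Vec.toList (allFin n))) (allVecs n k)

allPerms : (n : ℕ) → List (Map n)
allPerms n = filter (λ σ → T? (isPerm σ)) (allVecs n n)
  where
    open import Relation.Nullary using (Dec; yes; no)
    open import Data.Unit using (tt)
    T? : (b : Bool) → Dec (T b)
    T? true = yes tt
    T? false = no (λ ())

countPerms : (n : ℕ) → (Map n → Bool) → ℕ
countPerms n p = length (filter (λ σ → T? (p σ)) (allPerms n))
  where
    open import Relation.Nullary using (Dec; yes; no)
    open import Data.Unit using (tt)
    T? : (b : Bool) → Dec (T b)
    T? true = yes tt
    T? false = no (λ ())

c3 : (n : ℕ) → Map n → ℕ
c3 n β = countPerms n λ α → H (α ∘ₚ β) (β ∘ₚ α) ≡ᵇ 3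

centralizerSize : (n : ℕ) → Map n → ℕ
centralizerSize n β = countPerms n λ α → allF λ a → lookup (α ∘ₚ β) a == lookup (β ∘ₚ α) a

iter : ∀ {n} → Map n → ℕ → Fin n → Fin n
iter β zero a = a
iter β (suc k) a = lookup β (iter β k a)

onCycleOfLength : ∀ {n} → Map n → ℕ → Fin n → Bool
onCycleOfLength β ℓ a =
  (1 <ᵇ ℓ + 1) ∧ (iter β ℓ a == a) ∧ allBelow ℓ
  where
    allBelow : ℕ → Bool
    allBelow zero = true
    allBelow (suc j) = allBelow j ∧ ((j ≡ᵇ 0) ∨ not (iter β j a == a))

isCycleMin : ∀ {n} → Map n → ℕ → Fin n → Bool
isCycleMin β ℓ a = minBelow ℓ
  where
    minBelow : ℕ → Bool
    minBelow zero = true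
    minBelow (suc j) = minBelow j ∧ ⌊ a ≤? iter β j a ⌋

-- c_ℓ(β) = number of cycles of β of length ℓ (fixed points are 1-cycles);
-- each cycle is counted once, via its least element.
cycleCount : ∀ {n} → Map n → ℕ → ℕ
cycleCount β ℓ = countF λ a → onCycleOfLength β ℓ a ∧ isCycleMin β ℓ a

sumFromTo : ℕ → ℕ → (ℕ → ℕ) → ℕ
sumFromTo a b f = lsum (map (λ i → f (a + i)) (upTo (suc b ∸ a)))

formulaFactor : (n : ℕ) → (c : ℕ → ℕ) → ℕ
formulaFactor n c =
  sumFromTo 3 n (λ ℓ → c ℓ * (ℓ C 3))
  + sumFromTo 1 n (λ ℓ → sumFromTo (suc ℓ) n (λ m → ℓ * m * c ℓ * c m))

{-# OPTIONS --safe #-}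
module Submission where

-- Write γ = αβα⁻¹: then H(αβ, βα) = 3 iff γ = β ∘ (a b c) for some 3-cycle.  Comparing the points fixed by β^s and by
-- γ^s shows which 3-cycles keep β in its conjugacy class: either β meets a, b, c on one cycle in this cyclic order, or,
-- up to rotating (a b c), b lies on a cycle of length s and c = β^s(a) lies on a longer cycle.  Conversely, for each
-- of these an explicit τ with τβτ⁻¹ = β ∘ (a b c) is glued from orbits.  Choosing a 3-cycle of the first kind amounts
-- to choosing three points of one cycle, and of the second kind to choosing a and b.  Hence α ↦ (3-cycle, τ⁻¹α)
-- is a bijection onto the pairs of such a 3-cycle and an element of the centralizer of β.

open import Defs
open import Data.Bool using (Bool; true; false; _∧_; _∨_; not; T; T?)
open import Data.Bool.Properties using (T-∧; T-∨)
open import Data.Empty using (⊥; ⊥-elim)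
open import Data.Fin using (Fin; zero; suc; _≟_; toℕ; fromℕ<) renaming (_≤_ to _≤ᶠ_; _≤?_ to _≤ᶠ?_)
open import Data.Fin.Properties
  using (any?; toℕ<n; toℕ-fromℕ<; toℕ-injective; pigeonhole; injective⇒≤) renaming (≤-antisym to ≤ᶠ-antisym)
open import Data.List using (List; []; _∷_; _++_; map; concatMap; filter; length; upTo; allFin; tabulate)
open import Data.List.Membership.Propositional using (_∈_; _∉_; find; lose)
open import Data.List.Membership.Propositional.Properties
  using (∈-∃++; ∈-++⁻; ∈-++⁺ˡ; ∈-++⁺ʳ; ∈-map⁺; ∈-map⁻; ∈-concatMap⁺; ∈-concatMap⁻; ∈-allFin; ∈-filter⁺;
         ∈-filter⁻; ∈-upTo⁺; ∈-upTo⁻)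
open import Data.List.Properties
  using (length-++-sucʳ; length-++; length-map; map-++; map-∘; map-cong; upTo-∷ʳ; length-upTo; length-tabulate)
open import Data.List.Relation.Binary.Subset.Propositional using (_⊆_)
open import Data.List.Relation.Unary.All using ([]; _∷_)
import Data.List.Relation.Unary.All as All
open import Data.List.Relation.Unary.AllPairs using ([]; _∷_)
open import Data.List.Relation.Unary.Any using (here; there)
open import Data.List.Relation.Unary.Unique.Propositional using (Unique)
open import Data.List.Relation.Unary.Unique.Propositional.Properties
  using (Unique[x∷xs]⇒x∉xs; allFin⁺; upTo⁺) renaming (++⁺ to Unique-++⁺; map⁺ to Unique-map⁺; filter⁺ to
         Unique-filter⁺)
open import Data.Nat
  using (ℕ; zero; suc; _+_; _*_; _∸_; _≤_; _<_; z≤n; s≤s; _≡ᵇ_; z<s; >-nonZero; _%_; _/_; _≤?_; _<ᵇ_) renaming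
         (_≟_ to _≟ⁿ_)
open import Data.Nat.Combinatorics using (_C_; nCk+nC[k+1]≡[n+1]C[k+1]; nC1≡n)
open import Data.Nat.DivMod using (m≡m%n+[m/n]*n; m%n<n)
open import Data.Nat.ListAction using () renaming (sum to lsum)
open import Data.Nat.ListAction.Properties using (sum-++)
open import Data.Nat.Properties
  using (module ≤-Reasoning; ≤-refl; ≤-trans; ≤-antisym; <-irrefl; 1+n≰n; m≤m+n; m+[n∸m]≡n; ∸-monoˡ-<;
         +-cancelˡ-≡; +-comm; m∸n≤m; +-identityʳ; <-trans; <⇒≤; m∸n+n≡m; +-assoc; +-monoˡ-<; m<n⇒0<n∸m; <-cmp;
         ≤-<-trans; <-≤-trans; ≰⇒>; ≮⇒≥; m<n+m; m<n⇒m<1+n; m≤n⇒m<n∨m≡n; n<1+n; ∸-monoʳ-<; +-cancelʳ-≤; <-asym;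
         <⇒≢; ≡ᵇ⇒≡; ≡⇒≡ᵇ)
open import Data.Nat.Solver using (module +-*-Solver)
open import Data.Product using (∃; _×_; _,_; proj₁; proj₂; ∃₂)
open import Data.Product.Properties using (,-injectiveˡ; ,-injectiveʳ)
open import Data.Sum using (_⊎_; inj₁; inj₂; [_,_])
open import Data.Vec using (Vec; []; _∷_; lookup)
import Data.Vec as Vec
open import Data.Vec.Properties using (lookup∘tabulate; tabulate∘lookup; tabulate-cong)
open import Function using (_∘_; id)
open import Function.Bundles using (Equivalence)
open import Relation.Binary using (tri<; tri≈; tri>)
open import Relation.Binary.PropositionalEquality
  using (_≡_; _≢_; refl; sym; trans; cong; cong₂; subst; module ≡-Reasoning; subst₂)
open import Relation.Nullary using (¬_; yes; no; contradiction; Dec)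
open import Relation.Nullary.Decidable using (toWitness; fromWitness; _⊎-dec_; map′; decidable-stable; ⌊_⌋)

-- Off `S` = {a, b, c} the maps `β` and `γ` agree, so `γ` consists of the arcs of `β` between
-- consecutive points of `S`, reconnected: it leaves `a`, `b`, `c` along the arcs by which `β`
-- leaves `b`, `c`, `a`. The arcs define a return permutation of `S`, which the twist multiplies by
-- (a b c). The identity becomes a 3-cycle, merging three cycles, and (a c b) becomes the identity,
-- splitting one cycle into three; neither keeps the number of cycles. (a b c) becomes (a c b), one
-- cycle of the same total length. A transposition, rotated so that it swaps a and c, has arcs a to
-- c, c to a, b to b of lengths s, r, t; the cycle lengths s + r and t become t + r and s, the same
-- multiset only for s = t. So a and b determine c, whence the factor ℓ m in the second sum. Cycle
-- types are never compared as such: counting the fixed points of one power, with the roles of `β`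
-- and `γ` also exchanged, already forces these cases. Distance 3 leads to twists because a
-- permutation that displaces exactly three points is a 3-cycle.

private variable
  A B : Set
  n : ℕ

-- Counting with duplicate-free lists

⊆⇒length≤ : {xs ys : List A} → Unique xs → xs ⊆ ys → length xs ≤ length ys
⊆⇒length≤ [] _ = z≤n
⊆⇒length≤ {xs = x ∷ xs} (x∉ ∷ u) sub with ∈-∃++ (sub (here refl))
... | ys₁ , ys₂ , refl = begin
    suc (length xs)            ≤⟨ s≤s (⊆⇒length≤ u skip) ⟩
    suc (length (ys₁ ++ ys₂))  ≡⟨ length-++-sucʳ ys₁ x ys₂ ⟨
    length (ys₁ ++ x ∷ ys₂)    ∎
  where
  open ≤-Reasoning
  skip : xs ⊆ ys₁ ++ ys₂
  skip y∈ with ∈-++⁻ ys₁ (sub (there y∈))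
  ... | inj₁ y∈ys₁           = ∈-++⁺ˡ y∈ys₁
  ... | inj₂ (here refl)     = contradiction y∈ (Unique[x∷xs]⇒x∉xs (x∉ ∷ u))
  ... | inj₂ (there y∈ys₂)   = ∈-++⁺ʳ ys₁ y∈ys₂

Unique-∷ : {x : A} {xs : List A} → x ∉ xs → Unique xs → Unique (x ∷ xs)
Unique-∷ x∉ u = All.tabulate (λ {y} y∈ x≡y → x∉ (subst (_∈ _) (sym x≡y) y∈)) ∷ u

Unique-map : {xs : List A} (f : A → B) → Unique xs →
  (∀ {x y} → x ∈ xs → y ∈ xs → f x ≡ f y → x ≡ y) → Unique (map f xs)
Unique-map f [] _ = []
Unique-map {xs = x ∷ xs} f (x∉ ∷ u) inj =
  Unique-∷ fx∉ (Unique-map f u λ x∈ y∈ → inj (there x∈) (there y∈))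
  where
  fx∉ : f x ∉ map f xs
  fx∉ fx∈ with ∈-map⁻ f fx∈
  ... | y , y∈ , eq = Unique[x∷xs]⇒x∉xs (x∉ ∷ u) (subst (_∈ xs) (sym (inj (here refl) (there y∈) eq)) y∈)

-- The comparison behind the points on cycles, the displaced points and the final count. Injectivity
-- is asked only on members of the list, since maps such as `(z , i)` to `pow f i z` are injective
-- only there.
bijection⇒length≡ : {xs : List A} {ys : List B} (f : A → B) → Unique xs → Unique ys →
  (∀ {x y} → x ∈ xs → y ∈ xs → f x ≡ f y → x ≡ y) →
  (∀ {x} → x ∈ xs → f x ∈ ys) →
  (∀ {y} → y ∈ ys → ∃ λ x → x ∈ xs × y ≡ f x) →
  length xs ≡ length ys
bijection⇒length≡ {xs = xs} {ys} f uxs uys inj into onto =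
  trans (sym (length-map f xs))
    (≤-antisym (⊆⇒length≤ (Unique-map f uxs inj) image⊆) (⊆⇒length≤ uys ⊆image))
  where
  image⊆ : map f xs ⊆ ys
  image⊆ y∈ with ∈-map⁻ f y∈
  ... | _ , x∈ , refl = into x∈
  ⊆image : ys ⊆ map f xs
  ⊆image y∈ with onto y∈
  ... | _ , x∈ , refl = ∈-map⁺ f x∈

Unique-concatMap : {xs : List A} (f : A → List B) → Unique xs → (∀ {x} → x ∈ xs → Unique (f x)) →
  (∀ {x y z} → z ∈ f x → z ∈ f y → x ≡ y) → Unique (concatMap f xs)
Unique-concatMap f [] _ _ = []
Unique-concatMap {xs = x ∷ xs} f (x∉ ∷ u) uf disjoint =
  Unique-++⁺ (uf (here refl)) (Unique-concatMap f u (uf ∘ there) disjoint) separate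
  where
  separate : ∀ {z} → ¬ (z ∈ f x × z ∈ concatMap f xs)
  separate (z∈fx , z∈) with find (∈-concatMap⁻ f {xs = xs} z∈)
  ... | y , y∈ , z∈fy =
    Unique[x∷xs]⇒x∉xs (x∉ ∷ u) (subst (_∈ xs) (sym (disjoint z∈fx z∈fy)) y∈)

-- Nested in the order of the sums in `formulaFactor`, so that lengths of these lists unfold into
-- those sums.
sigma : List A → (A → List B) → List (A × B)
sigma xs f = concatMap (λ x → map (x ,_) (f x)) xs

∈-sigma⁺ : {xs : List A} {f : A → List B} {x : A} {y : B} → x ∈ xs → y ∈ f x → (x , y) ∈ sigma xs f
∈-sigma⁺ {f = f} x∈ y∈ = ∈-concatMap⁺ (λ x → map (x ,_) (f x)) (lose x∈ (∈-map⁺ (_ ,_) y∈))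

∈-sigma⁻ : (xs : List A) (f : A → List B) {x : A} {y : B} → (x , y) ∈ sigma xs f → x ∈ xs × y ∈ f x
∈-sigma⁻ xs f p with find (∈-concatMap⁻ (λ x → map (x ,_) (f x)) {xs = xs} p)
... | x , x∈ , q with ∈-map⁻ (x ,_) q
... | y , y∈ , refl = x∈ , y∈

Unique-sigma : {xs : List A} {f : A → List B} → Unique xs → (∀ {x} → x ∈ xs → Unique (f x)) → Unique (sigma xs f)
Unique-sigma {f = f} uxs uf =
  Unique-concatMap _ uxs (λ x∈ → Unique-map⁺ (λ { refl → refl }) (uf x∈)) same
  where
  same : ∀ {x y z} → z ∈ map (x ,_) (f x) → z ∈ map (y ,_) (f y) → x ≡ y
  same p q with ∈-map⁻ _ p | ∈-map⁻ _ q
  ... | _ , _ , refl | _ , _ , refl = refl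

length-sigma : (xs : List A) (f : A → List B) → length (sigma xs f) ≡ lsum (map (length ∘ f) xs)
length-sigma []       f = refl
length-sigma (x ∷ xs) f = trans (length-++ (map (x ,_) (f x)))
  (cong₂ _+_ (length-map (x ,_) (f x)) (length-sigma xs f))

length-sigma-const : (xs : List A) (ys : List B) → length (sigma xs λ _ → ys) ≡ length xs * length ys
length-sigma-const []       ys = refl
length-sigma-const (x ∷ xs) ys = trans (length-++ (map (x ,_) ys))
  (cong₂ _+_ (length-map (x ,_) ys) (length-sigma-const xs ys))

-- Has the same index list `upTo (suc b ∸ a)` as `sumFromTo`, including the empty list for a > b.
range : ℕ → ℕ → List ℕ
range a b = map (a +_) (upTo (suc b ∸ a))

∈-range⁺ : ∀ {a b i} → a ≤ i → i ≤ b → i ∈ range a b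
∈-range⁺ {a} {b} a≤i i≤b = subst (_∈ range a b) (m+[n∸m]≡n a≤i)
  (∈-map⁺ (a +_) (∈-upTo⁺ (∸-monoˡ-< (s≤s i≤b) a≤i)))

∈-range⁻ : ∀ a {b i} → i ∈ range a b → a ≤ i
∈-range⁻ a i∈ with ∈-map⁻ (a +_) i∈
... | j , _ , refl = m≤m+n a j

Unique-range : ∀ a b → Unique (range a b)
Unique-range a b = Unique-map⁺ (+-cancelˡ-≡ a _ _) (upTo⁺ (suc b ∸ a))

length-sigma-range : ∀ a b (f : ℕ → List A) (g : ℕ → ℕ) → (∀ i → length (f i) ≡ g i) →
  length (sigma (range a b) f) ≡ sumFromTo a b g
length-sigma-range a b f g eq = trans (length-sigma (range a b) f)
  (cong lsum (trans (sym (map-∘ (upTo (suc b ∸ a)))) (map-cong (λ i → eq (a + i)) (upTo (suc b ∸ a)))))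

length-sigma-upTo : ∀ k n (f : ℕ → List A) → (∀ i → length (f i) ≡ i C k) →
  length (sigma (upTo n) f) ≡ n C suc k
length-sigma-upTo k n f eq = trans (length-sigma (upTo n) f)
    (trans (cong lsum (map-cong eq (upTo n))) (hockeyStick n))
  where
  open ≡-Reasoning
  hockeyStick : ∀ n → lsum (map (_C k) (upTo n)) ≡ n C suc k
  hockeyStick zero    = refl
  hockeyStick (suc n) = begin
    lsum (map (_C k) (upTo (suc n)))             ≡⟨ cong (lsum ∘ map (_C k)) (upTo-∷ʳ n) ⟨
    lsum (map (_C k) (upTo n ++ n ∷ []))         ≡⟨ cong lsum (map-++ (_C k) (upTo n) (n ∷ [])) ⟩
    lsum (map (_C k) (upTo n) ++ n C k ∷ [])     ≡⟨ sum-++ (map (_C k) (upTo n)) (n C k ∷ []) ⟩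
    lsum (map (_C k) (upTo n)) + (n C k + 0)     ≡⟨ cong₂ _+_ (hockeyStick n) (+-identityʳ (n C k)) ⟩
    n C suc k + n C k                            ≡⟨ +-comm (n C suc k) (n C k) ⟩
    n C k + n C suc k                            ≡⟨ nCk+nC[k+1]≡[n+1]C[k+1] n k ⟩
    suc n C suc k                                ∎

-- The 3-element subsets of {0, ..., ℓ - 1}, written in decreasing order: each entry bounds the
-- next, and two uses of the hockey-stick identity give the length.
triples : ℕ → List (ℕ × ℕ × ℕ)
triples ℓ = sigma (upTo ℓ) λ k → sigma (upTo k) upTo

length-triples : ∀ ℓ → length (triples ℓ) ≡ ℓ C 3
length-triples ℓ = length-sigma-upTo 2 ℓ _ λ k → length-sigma-upTo 1 k upTo λ j →
  trans (length-upTo j) (sym (nC1≡n j))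

Unique-triples : ∀ ℓ → Unique (triples ℓ)
Unique-triples ℓ = Unique-sigma (upTo⁺ ℓ) λ {k} _ → Unique-sigma (upTo⁺ k) λ {j} _ → upTo⁺ j

-- The search results are abstract because with-abstraction over them would otherwise normalise the whole search.
abstract
  injective⇒surjective : (f : Fin n → Fin n) → (∀ {x y} → f x ≡ f y → x ≡ y) → ∀ y → ∃ λ x → f x ≡ y
  injective⇒surjective {n} f inj y with Data.Fin.Properties.any? (λ x → f x ≟ y)
    where import Data.Fin.Properties
  ... | yes p = p
  ... | no ¬p = contradiction (begin
      suc n                                ≡⟨ cong suc (length-tabulate id) ⟨
      suc (length (allFin n))              ≡⟨ cong suc (length-map f (allFin n)) ⟨
      suc (length (map f (allFin n)))      ≤⟨ ⊆⇒length≤ (Unique-∷ y∉ (Unique-map⁺ inj (allFin⁺ n))) (λ {x} _ → ∈-allFin x) ⟩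
      length (allFin n)                    ≡⟨ length-tabulate id ⟩
      n                                    ∎) 1+n≰n
    where
    open ≤-Reasoning
    y∉ : y ∉ map f (allFin n)
    y∉ y∈ with ∈-map⁻ f y∈
    ... | x , _ , eq = ¬p (x , sym eq)

-- A right inverse of `f` is injective, hence surjective by finiteness, hence also a left inverse.
-- For the glued conjugators below, preimages can be written down, so surjectivity is the accessible
-- half.
surjective⇒injective : (f : Fin n → Fin n) → (∀ y → ∃ λ x → f x ≡ y) → ∀ {x y} → f x ≡ f y → x ≡ y
surjective⇒injective f surj {x} {y} eq = begin
    x              ≡⟨ gf x ⟨
    g (f x)        ≡⟨ cong g eq ⟩
    g (f y)        ≡⟨ gf y ⟩
    y              ∎
  where
  open ≡-Reasoning
  g : Fin _ → Fin _
  g = proj₁ ∘ surj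
  fg : ∀ y → f (g y) ≡ y
  fg = proj₂ ∘ surj
  gf : ∀ x → g (f x) ≡ x
  gf x with injective⇒surjective g (λ {u} {v} p → trans (sym (fg u)) (trans (cong f p) (fg v))) x
  ... | u , refl = cong g (fg u)

-- Boolean tests as propositions, and the enumerations behind the counts

T-∧⁻ : ∀ {x y} → T (x ∧ y) → T x × T y
T-∧⁻ = Equivalence.to T-∧

T-∧⁺ : ∀ {x y} → T x → T y → T (x ∧ y)
T-∧⁺ p q = Equivalence.from T-∧ (p , q)

T-not⁺ : ∀ {x} → ¬ T x → T (not x)
T-not⁺ {false} _  = _
T-not⁺ {true}  ¬t = ⊥-elim (¬t _)

T-not⁻ : ∀ {x} → T (not x) → ¬ T x
T-not⁻ {false} _ ()

T-allF⁻ : (p : Fin n → Bool) → T (allF p) → ∀ a → T (p a)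
T-allF⁻ p t zero    = proj₁ (T-∧⁻ {p zero} t)
T-allF⁻ p t (suc a) = T-allF⁻ (p ∘ suc) (proj₂ (T-∧⁻ {p zero} t)) a

T-allF⁺ : (p : Fin n → Bool) → (∀ a → T (p a)) → T (allF p)
T-allF⁺ {zero}  p t = _
T-allF⁺ {suc n} p t = T-∧⁺ (t zero) (T-allF⁺ (p ∘ suc) (t ∘ suc))

length-filter-tabulate : ∀ {m} (p : A → Bool) (f : Fin m → A) →
  countF (p ∘ f) ≡ length (filter (T? ∘ p) (tabulate f))
length-filter-tabulate {m = zero}  p f = refl
length-filter-tabulate {m = suc m} p f with p (f zero)
... | true  = cong suc (length-filter-tabulate p (f ∘ suc))
... | false = length-filter-tabulate p (f ∘ suc)

satisfying : (Fin n → Bool) → List (Fin n)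
satisfying p = filter (T? ∘ p) (allFin _)

countF≡length : (p : Fin n → Bool) → countF p ≡ length (satisfying p)
countF≡length p = length-filter-tabulate p id

∈-satisfying⁺ : (p : Fin n → Bool) {x : Fin n} → T (p x) → x ∈ satisfying p
∈-satisfying⁺ p px = ∈-filter⁺ (T? ∘ p) (∈-allFin _) px

∈-satisfying⁻ : (p : Fin n → Bool) {x : Fin n} → x ∈ satisfying p → T (p x)
∈-satisfying⁻ p x∈ = proj₂ (∈-filter⁻ (T? ∘ p) {xs = allFin _} x∈)

Unique-satisfying : (p : Fin n → Bool) → Unique (satisfying p)
Unique-satisfying p = Unique-filter⁺ (T? ∘ p) (allFin⁺ _)

toList-tabulate : ∀ {m} (f : Fin m → A) → Vec.toList (Vec.tabulate f) ≡ tabulate f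
toList-tabulate {m = zero}  f = refl
toList-tabulate {m = suc m} f = cong (f zero ∷_) (toList-tabulate (f ∘ suc))

∈-allVecs : ∀ {n k} (v : Vec (Fin n) k) → v ∈ allVecs n k
∈-allVecs {n} [] = here refl
∈-allVecs {n} (x ∷ v) = ∈-concatMap⁺ (λ w → map (_∷ w) (Vec.toList (Vec.allFin n)))
  (lose (∈-allVecs v) (∈-map⁺ (_∷ v) (subst (x ∈_) (sym (toList-tabulate id)) (∈-allFin x))))

Unique-allVecs : ∀ n k → Unique (allVecs n k)
Unique-allVecs n zero    = [] ∷ []
Unique-allVecs n (suc k) = Unique-concatMap _ (Unique-allVecs n k)
  (λ _ → Unique-map⁺ (λ { refl → refl }) (subst Unique (sym (toList-tabulate id)) (allFin⁺ n))) same
  where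
  same : ∀ {v w : Vec (Fin n) k} {z} → z ∈ map (_∷ v) (Vec.toList (Vec.allFin n)) →
    z ∈ map (_∷ w) (Vec.toList (Vec.allFin n)) → v ≡ w
  same p q with ∈-map⁻ _ p | ∈-map⁻ _ q
  ... | _ , _ , refl | _ , _ , refl = refl

Injective : {A B : Set} → (A → B) → Set
Injective f = ∀ {x y} → f x ≡ f y → x ≡ y

==⁻ : (a b : Fin n) → T (a == b) → a ≡ b
==⁻ a b t with a ≟ b
... | yes eq = eq

==⁺ : {a b : Fin n} → a ≡ b → T (a == b)
==⁺ {a = a} refl with a ≟ a
... | yes _  = _
... | no a≢a = a≢a refl

isPerm⁻ : (σ : Map n) → T (isPerm σ) → Injective (lookup σ)
isPerm⁻ σ t {a} {b} eq with Equivalence.to (T-∨ {a == b}) (T-allF⁻ _ (T-allF⁻ _ t a) b)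
... | inj₁ a==b = ==⁻ a b a==b
... | inj₂ ne   = contradiction (==⁺ eq) (T-not⁻ {lookup σ a == lookup σ b} ne)

isPerm⁺ : (σ : Map n) → Injective (lookup σ) → T (isPerm σ)
isPerm⁺ σ inj = T-allF⁺ _ λ a → T-allF⁺ _ λ b → Equivalence.from T-∨ (cases a b)
  where
  cases : ∀ a b → T (a == b) ⊎ T (not (lookup σ a == lookup σ b))
  cases a b with a ≟ b
  ... | yes _   = inj₁ _
  ... | no a≢b  = inj₂ (T-not⁺ λ t → a≢b (inj (==⁻ (lookup σ a) (lookup σ b) t)))

record Enumerates (P : A → Set) (xs : List A) : Set where
  field
    unique : Unique xs
    sound : ∀ {x} → x ∈ xs → P x
    complete : ∀ {x} → P x → x ∈ xs

countPerms-enumerates : (p : Map n → Bool) →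
  ∃ λ xs → countPerms n p ≡ length xs × Enumerates (λ σ → Injective (lookup σ) × T (p σ)) xs
-- The list is the double filter to which `countPerms` unfolds; unification finds it together with
-- the decision procedures local to the definitions.
countPerms-enumerates {n} p = _ , refl , record
  { unique = Unique-filter⁺ _ (Unique-filter⁺ _ (Unique-allVecs n n))
  ; sound = λ {σ} σ∈ →
      let σ∈perms , pσ = ∈-filter⁻ _ {xs = allPerms n} σ∈
          _ , perm = ∈-filter⁻ _ {xs = allVecs n n} σ∈perms
      in (λ {x} {y} → isPerm⁻ σ perm {x} {y}) , pσ
  ; complete = λ { {σ} (inj , pσ) → ∈-filter⁺ _ (∈-filter⁺ _ (∈-allVecs σ) (isPerm⁺ σ inj)) pσ }
  }

-- Iterates, periods and orbits

least : {P : ℕ → Set} → (∀ k → Dec (P k)) → ∀ {m} → P m → ∃ λ k → P k × k ≤ m × (∀ {j} → j < k → ¬ P j)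
least {P} P? {m} pm with search (suc m)
  where
  search : ∀ m → (∃ λ k → P k × k < m × (∀ {j} → j < k → ¬ P j)) ⊎ (∀ {j} → j < m → ¬ P j)
  search zero = inj₂ λ ()
  search (suc m) with search m | P? m
  ... | inj₁ (k , pk , k<m , min) | _ = inj₁ (k , pk , m<n⇒m<1+n k<m , min)
  ... | inj₂ none | yes pm = inj₁ (m , pm , n<1+n m , none)
  ... | inj₂ none | no ¬pm = inj₂ extend
    where
    extend : ∀ {j} → j < suc m → ¬ P j
    extend (s≤s j≤m) with m≤n⇒m<n∨m≡n j≤m
    ... | inj₁ j<m  = none j<m
    ... | inj₂ refl = ¬pm
... | inj₁ (k , pk , s≤s k≤m , min) = k , pk , k≤m , min
... | inj₂ none = contradiction pm (none ≤-refl)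

pow : (A → A) → ℕ → A → A
pow f zero    x = x
pow f (suc k) x = f (pow f k x)

pow-+ : (f : A → A) → ∀ k m x → pow f (k + m) x ≡ pow f k (pow f m x)
pow-+ f zero    m x = refl
pow-+ f (suc k) m x = cong f (pow-+ f k m x)

pow-comm : (f : A → A) → ∀ k m x → pow f k (pow f m x) ≡ pow f m (pow f k x)
pow-comm f k m x = trans (sym (pow-+ f k m x)) (trans (cong (λ t → pow f t x) (+-comm k m)) (pow-+ f m k x))

pow-injective : {f : A → A} → Injective f → ∀ k → Injective (pow f k)
pow-injective inj zero    eq = eq
pow-injective inj (suc k) eq = pow-injective inj k (inj eq)

pow-semiconj : {α f g : A → A} → (∀ x → α (f x) ≡ g (α x)) → ∀ k x → α (pow f k x) ≡ pow g k (α x)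
pow-semiconj comm zero    x = refl
pow-semiconj {g = g} comm (suc k) x = trans (comm _) (cong g (pow-semiconj comm k x))

pow-cancel : {f : A → A} → Injective f → ∀ {i j x} → i ≤ j → pow f i x ≡ pow f j x → pow f (j ∸ i) x ≡ x
pow-cancel {f = f} inj {i} {j} {x} i≤j eq = pow-injective inj i (begin
    pow f i (pow f (j ∸ i) x)  ≡⟨ pow-+ f i (j ∸ i) x ⟨
    pow f (i + (j ∸ i)) x      ≡⟨ cong (λ t → pow f t x) (m+[n∸m]≡n i≤j) ⟩
    pow f j x                  ≡⟨ eq ⟨
    pow f i x                  ∎)
  where open ≡-Reasoning

pow-multiple : (f : A → A) → ∀ {ℓ x} → pow f ℓ x ≡ x → ∀ u q → pow f (u + q * ℓ) x ≡ pow f u x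
pow-multiple f {ℓ} {x} ret u q = trans (pow-+ f u (q * ℓ) x) (cong (pow f u) (multiple q))
  where
  multiple : ∀ q → pow f (q * ℓ) x ≡ x
  multiple zero    = refl
  multiple (suc q) = trans (pow-+ f ℓ (q * ℓ) x) (trans (cong (pow f ℓ) (multiple q)) ret)

record IsPeriod (f : A → A) (ℓ : ℕ) (x : A) : Set where
  constructor isPeriod
  field
    positive : 0 < ℓ
    returns : pow f ℓ x ≡ x
    minimal : ∀ {t} → 0 < t → t < ℓ → pow f t x ≢ x

open IsPeriod

period-unique : {f : A → A} → ∀ {ℓ m x} → IsPeriod f ℓ x → IsPeriod f m x → ℓ ≡ m
period-unique {ℓ = ℓ} {m} p q with <-cmp ℓ m
... | tri< ℓ<m _ _ = contradiction (returns p) (minimal q (positive p) ℓ<m)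
... | tri≈ _ eq _  = eq
... | tri> _ _ m<ℓ = contradiction (returns q) (minimal p (positive q) m<ℓ)

period-injective : {f : A → A} → Injective f → ∀ {ℓ x i j} → IsPeriod f ℓ x →
  i < ℓ → j < ℓ → pow f i x ≡ pow f j x → i ≡ j
period-injective inj {i = i} {j} p i<ℓ j<ℓ eq with <-cmp i j
... | tri< i<j _ _ = contradiction (pow-cancel inj (<⇒≤ i<j) eq)
                       (minimal p (m<n⇒0<n∸m i<j) (≤-<-trans (m∸n≤m j i) j<ℓ))
... | tri≈ _ i≡j _ = i≡j
... | tri> _ _ j<i = contradiction (pow-cancel inj (<⇒≤ j<i) (sym eq))
                       (minimal p (m<n⇒0<n∸m j<i) (≤-<-trans (m∸n≤m i j) i<ℓ))

period-pow : {f : A → A} → Injective f → ∀ {ℓ x} k → IsPeriod f ℓ x → IsPeriod f ℓ (pow f k x)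
period-pow {f = f} inj {ℓ} {x} k p = isPeriod (positive p)
  (trans (pow-comm f ℓ k x) (cong (pow f k) (returns p)))
  (λ {t} 0<t t<ℓ eq → minimal p 0<t t<ℓ (pow-injective inj k (trans (pow-comm f k t x) eq)))

Orbit : (A → A) → A → A → Set
Orbit f x y = ∃ λ t → pow f t x ≡ y

remainder : ∀ {ℓ} → 0 < ℓ → ∀ t → ∃₂ λ u q → u < ℓ × t ≡ u + q * ℓ
remainder {ℓ} 0<ℓ t = t % ℓ , t / ℓ , m%n<n t ℓ , m≡m%n+[m/n]*n t ℓ
  where instance _ = >-nonZero 0<ℓ

orbit-bounded : {f : A → A} → ∀ {ℓ x y} → IsPeriod f ℓ x → Orbit f x y → ∃ λ t → t < ℓ × pow f t x ≡ y
orbit-bounded {f = f} p (t , refl) with remainder (positive p) t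
... | u , q , u<ℓ , refl = u , u<ℓ , sym (pow-multiple f (returns p) u q)

orbit-sym : {f : A → A} → ∀ {ℓ x y} → IsPeriod f ℓ x → Orbit f x y → Orbit f y x
orbit-sym {f = f} {ℓ} {x} p o with orbit-bounded p o
... | u , u<ℓ , refl = ℓ ∸ u , trans (sym (pow-+ f (ℓ ∸ u) u x))
  (trans (cong (λ t → pow f t x) (m∸n+n≡m (<⇒≤ u<ℓ))) (returns p))

orbit-trans : {f : A → A} → ∀ {x y z} → Orbit f x y → Orbit f y z → Orbit f x z
orbit-trans {f = f} (s , refl) (t , refl) = t + s , pow-+ f t s _

orbit-pred : {f : A → A} → Injective f → ∀ {ℓ x y} → IsPeriod f ℓ x → Orbit f x (f y) → Orbit f x y
orbit-pred inj p (suc t , eq) = t , inj eq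
-- Here `f y` is the base point itself, so `y` is the last point of its cycle.
orbit-pred {f = f} inj {suc ℓ} p (zero , eq) = ℓ , inj (trans (returns p) eq)

orbit-period : {f : A → A} → Injective f → ∀ {ℓ x y} → IsPeriod f ℓ x → Orbit f x y → IsPeriod f ℓ y
orbit-period inj p (k , refl) = period-pow inj k p

module _ {f : Fin n → Fin n} (inj : Injective f) where

  period-≤ : ∀ {ℓ x} → IsPeriod f ℓ x → ℓ ≤ n
  period-≤ {ℓ} {x} p = injective⇒≤ {f = λ (i : Fin ℓ) → pow f (toℕ i) x}
    (λ {i} {j} eq → toℕ-injective (period-injective inj p (toℕ<n i) (toℕ<n j) eq))

  abstract
    period-exists : ∀ x → ∃ λ ℓ → IsPeriod f ℓ x
    -- Two of n + 1 iterates coincide and cancel to a return of `x`. The search runs over `suc k`,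
    -- so the least witness is a positive period.
    period-exists x with pigeonhole (n<1+n n) (λ i → pow f (toℕ i) x)
    ... | i , j , i<j , eq with least (λ k → pow f (suc k) x ≟ x)
          {m = toℕ j ∸ suc (toℕ i)} (subst (λ t → pow f t x ≡ x) (shift i<j) (pow-cancel inj (<⇒≤ i<j) eq))
      where
      shift : ∀ {i j} → i < j → j ∸ i ≡ suc (j ∸ suc i)
      shift {zero}  {suc j} _         = refl
      shift {suc i} {suc j} (s≤s i<j) = shift i<j
    ... | k , ret , _ , min = suc k , isPeriod z<s ret λ { {suc t} _ (s≤s t<k) → min t<k }

  abstract
    orbit? : ∀ x y → Dec (Orbit f x y)
    orbit? x y with period-exists x
    ... | ℓ , p = map′ (λ { (i , eq) → toℕ i , eq }) bounded (any? λ (i : Fin ℓ) → pow f (toℕ i) x ≟ y)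
      where
      bounded : Orbit f x y → ∃ λ (i : Fin ℓ) → pow f (toℕ i) x ≡ y
      bounded o with orbit-bounded p o
      ... | t , t<ℓ , eq = fromℕ< t<ℓ , trans (cong (λ u → pow f u x) (toℕ-fromℕ< t<ℓ)) eq

-- First returns to a set, and twists by a 3-cycle

-- The arc from `x` to the next point `y` of `S`, of length `s`; `y` is `x` again when a cycle meets
-- `S` in `x` alone. These arcs are the pieces that a twist reconnects.
record FirstReturn (f : A → A) (S : A → Set) (s : ℕ) (x y : A) : Set where
  constructor firstReturn
  field
    positive : 0 < s
    arrives : pow f s x ≡ y
    target : S y
    avoids : ∀ {t} → 0 < t → t < s → ¬ S (pow f t x)

module Return = FirstReturn

abstract
  firstReturn-exists : {f : Fin n → Fin n} → Injective f → {S : Fin n → Set} → (∀ y → Dec (S y)) →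
    ∀ {x} → S x → ∃₂ λ s y → FirstReturn f S s x y
  firstReturn-exists {f = f} inj {S} S? {x} Sx with period-exists inj x
  ... | zero , isPeriod () _ _
  -- The search is bounded because `x` lies in `S` and comes back to itself after a full period.
  ... | suc ℓ , p with least (λ k → S? (pow f (suc k) x)) {m = ℓ} (subst S (sym (returns p)) Sx)
  ... | k , Sk , _ , min = suc k , _ , firstReturn z<s refl Sk λ { {suc t} _ (s≤s t<k) → min t<k }

-- Going back `s` steps from the common end `y` leads to `x`, which would be a point of `S` inside
-- the longer arc.
firstReturn-source-< : {f : A → A} → Injective f → {S : A → Set} → ∀ {s s′ x x′ y} → S x →
  FirstReturn f S s x y → FirstReturn f S s′ x′ y → ¬ s < s′
firstReturn-source-< {f = f} inj {S} {s} {s′} {x} {x′} Sx r r′ s<s′ =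
  Return.avoids r′ (m<n⇒0<n∸m s<s′) (∸-monoʳ-< (Return.positive r) (<⇒≤ s<s′)) (subst S back Sx)
  where
  open ≡-Reasoning
  back : x ≡ pow f (s′ ∸ s) x′
  back = pow-injective inj s (begin
    pow f s x                    ≡⟨ Return.arrives r ⟩
    _                            ≡⟨ Return.arrives r′ ⟨
    pow f s′ x′                  ≡⟨ cong (λ t → pow f t x′) (m+[n∸m]≡n (<⇒≤ s<s′)) ⟨
    pow f (s + (s′ ∸ s)) x′      ≡⟨ pow-+ f s (s′ ∸ s) x′ ⟩
    pow f s (pow f (s′ ∸ s) x′)  ∎)

firstReturn-source : {f : A → A} → Injective f → {S : A → Set} → ∀ {s s′ x x′ y} → S x → S x′ →
  FirstReturn f S s x y → FirstReturn f S s′ x′ y → x ≡ x′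
firstReturn-source inj {s = s} {s′} Sx Sx′ r r′ with <-cmp s s′
... | tri< s<s′ _ _  = contradiction s<s′ (firstReturn-source-< inj Sx r r′)
... | tri> _ _ s′<s  = contradiction s′<s (firstReturn-source-< inj Sx′ r′ r)
... | tri≈ _ refl _  = pow-injective inj s (trans (Return.arrives r) (sym (Return.arrives r′)))

-- γ = β ∘ (a b c), where S = {a, b, c}.
record Twist (S : A → Set) (β γ : A → A) (a b c : A) : Set where
  field
    a≢b : a ≢ b
    b≢c : b ≢ c
    c≢a : c ≢ a
    Sa : S a
    Sb : S b
    Sc : S c
    cases : ∀ {y} → S y → y ≡ a ⊎ y ≡ b ⊎ y ≡ c
    at-a : γ a ≡ β b
    at-b : γ b ≡ β c
    at-c : γ c ≡ β a
    off : ∀ {y} → ¬ S y → γ y ≡ β y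

rotate : {S : A → Set} {β γ : A → A} → ∀ {a b c} → Twist S β γ a b c → Twist S β γ b c a
rotate w = record
  { a≢b = b≢c ; b≢c = c≢a ; c≢a = a≢b ; Sa = Sb ; Sb = Sc ; Sc = Sa
  ; cases = λ Sy → case-rotate (cases Sy)
  ; at-a = at-b ; at-b = at-c ; at-c = at-a ; off = off }
  where
  open Twist w
  case-rotate : {P Q R : Set} → P ⊎ Q ⊎ R → Q ⊎ R ⊎ P
  case-rotate (inj₁ p)        = inj₂ (inj₂ p)
  case-rotate (inj₂ (inj₁ q)) = inj₁ q
  case-rotate (inj₂ (inj₂ r)) = inj₂ (inj₁ r)

-- The inverse of (a b c) is (a c b). This lets results about `β` be applied to `γ`.
twist-sym : {S : A → Set} {β γ : A → A} → ∀ {a b c} → Twist S β γ a b c → Twist S γ β a c b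
twist-sym w = record
  { a≢b = c≢a ∘ sym ; b≢c = b≢c ∘ sym ; c≢a = a≢b ∘ sym ; Sa = Sa ; Sb = Sc ; Sc = Sb
  ; cases = λ Sy → case-swap (cases Sy)
  ; at-a = sym at-c ; at-b = sym at-b ; at-c = sym at-a ; off = sym ∘ off }
  where
  open Twist w
  case-swap : {P Q R : Set} → P ⊎ Q ⊎ R → P ⊎ R ⊎ Q
  case-swap (inj₁ p)        = inj₁ p
  case-swap (inj₂ (inj₁ q)) = inj₂ (inj₂ q)
  case-swap (inj₂ (inj₂ r)) = inj₂ (inj₁ r)

twist-dec : {S : Fin n → Set} {β γ : Fin n → Fin n} → ∀ {a b c} → Twist S β γ a b c → ∀ y → Dec (S y)
twist-dec {a = a} {b} {c} w y =
  map′ (λ { (inj₁ refl) → Sa ; (inj₂ (inj₁ refl)) → Sb ; (inj₂ (inj₂ refl)) → Sc }) cases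
    (y ≟ a ⊎-dec (y ≟ b ⊎-dec y ≟ c))
  where open Twist w

module _ {S : A → Set} {β γ : A → A} {a b c : A} (w : Twist S β γ a b c) where

  -- The first step puts `γ` on the arc leaving `x`, and outside `S` the two maps agree, so `γ`
  -- follows this arc to its end. With `v` = `a`, `b`, `c` the arc is that of `b`, `c`, `a`.
  twist-path : ∀ {s x y v} → FirstReturn β S s x y → γ v ≡ β x →
    ∀ {t} → 0 < t → t ≤ s → pow γ t v ≡ pow β t x
  twist-path r γv≡βx {suc zero}    _ _    = γv≡βx
  twist-path r γv≡βx {suc (suc t)} _ t<s =
    trans (cong γ (twist-path r γv≡βx z<s (<⇒≤ t<s))) (Twist.off w (Return.avoids r z<s t<s))

  twist-return : ∀ {s x y v} → FirstReturn β S s x y → γ v ≡ β x → FirstReturn γ S s v y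
  twist-return r γv≡βx = firstReturn (Return.positive r)
    (trans (twist-path r γv≡βx (Return.positive r) ≤-refl) (Return.arrives r)) (Return.target r)
    (λ 0<t t<s → Return.avoids r 0<t t<s ∘ subst S (twist-path r γv≡βx 0<t (<⇒≤ t<s)))

-- Necessity: conjugacy restricts the 3-cycle

record Conjugate (β γ : A → A) : Set where
  field
    conj : A → A
    conj-injective : Injective conj
    intertwines : ∀ x → conj (β x) ≡ γ (conj x)

conjugate-sym : {β γ : Fin n → Fin n} → Conjugate β γ → Conjugate γ β
conjugate-sym {β = β} {γ} κ = record
  { conj = inv
  ; conj-injective = λ {x} {y} eq → trans (sym (conj-inv x)) (trans (cong conj eq) (conj-inv y))
  ; intertwines = λ x → conj-injective (begin
      conj (inv (γ x))   ≡⟨ conj-inv (γ x) ⟩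
      γ x                ≡⟨ cong γ (conj-inv x) ⟨
      γ (conj (inv x))   ≡⟨ intertwines (inv x) ⟨
      conj (β (inv x))   ∎)
  }
  where
  open Conjugate κ
  open ≡-Reasoning
  inv = λ y → proj₁ (injective⇒surjective conj conj-injective y)
  conj-inv = λ y → proj₂ (injective⇒surjective conj conj-injective y)

-- Conjugate permutations have equally many points fixed by their s-th powers.
conjugate-fixed : {β γ : Fin n → Fin n} → Conjugate β γ → ∀ s →
  (∀ x → pow β s x ≡ x → pow γ s x ≡ x) → ∀ y → pow γ s y ≡ y → pow β s y ≡ y
conjugate-fixed {n} {β} {γ} κ s β⇒γ y γy =
  decidable-stable (pow β s y ≟ y) λ ¬βy → 1+n≰n (begin
    suc (length (fixed β))        ≤⟨ ⊆⇒length≤ (Unique-∷ (¬βy ∘ fixed⁻ β) (unique β)) (bound ¬βy) ⟩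
    length (map conj (fixed β))   ≡⟨ length-map conj (fixed β) ⟩
    length (fixed β)              ∎)
  where
  open ≤-Reasoning
  open Conjugate κ
  fixed : (Fin n → Fin n) → List (Fin n)
  fixed f = filter (λ x → pow f s x ≟ x) (allFin n)
  fixed⁻ : ∀ f {x} → x ∈ fixed f → pow f s x ≡ x
  fixed⁻ f x∈ = proj₂ (∈-filter⁻ (λ x → pow f s x ≟ x) {xs = allFin n} x∈)
  unique = λ f → Unique-filter⁺ (λ x → pow f s x ≟ x) (allFin⁺ n)
  image : ∀ {x} → pow γ s x ≡ x → x ∈ map conj (fixed β)
  image {x} γx with injective⇒surjective conj conj-injective x
  ... | u , refl = ∈-map⁺ conj (∈-filter⁺ (λ x → pow β s x ≟ x) (∈-allFin u)
    (conj-injective (trans (pow-semiconj intertwines s u) γx)))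
  bound : ¬ pow β s y ≡ y → ∀ {x} → x ∈ y ∷ fixed β → x ∈ map conj (fixed β)
  bound _ (here refl)  = image γy
  bound _ (there x∈)   = image (β⇒γ _ (fixed⁻ β x∈))

-- In γ the first return from a to c closes up into a cycle of length s, so if b were not fixed by β^s then γ^s
-- would have more fixed points than β^s.
twist-fixed : {S : Fin n → Set} {β γ : Fin n → Fin n} → ∀ {a b c s} → Injective β → Conjugate β γ →
  Twist S β γ a b c → FirstReturn β S s a c → pow β s b ≡ b
twist-fixed {S = S} {β} {γ} {a} {b} {c} {s} inj κ w r = decidable-stable (pow β s b ≟ b) λ b-moves →
  c-moves (conjugate-fixed κ s (β⇒γ b-moves) c (Return.arrives (twist-return w r at-c)))
  where
  open Twist w
  a-moves : pow β s a ≢ a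
  a-moves eq = c≢a (trans (sym (Return.arrives r)) eq)
  c-moves : pow β s c ≢ c
  c-moves eq = c≢a (sym (pow-injective inj s (trans (Return.arrives r) (sym eq))))
  β⇒γ : pow β s b ≢ b → ∀ x → pow β s x ≡ x → pow γ s x ≡ x
  β⇒γ b-moves x fix = trans (same s) fix
    where
    orbit-fix : ∀ t → pow β s (pow β t x) ≡ pow β t x
    orbit-fix t = trans (pow-comm β s t x) (cong (pow β t) fix)
    -- The whole orbit of `x` is fixed by `pow β s`, whereas none of `a`, `b`, `c` is; so `γ` and
    -- `β` agree along it.
    orbit-avoids : ∀ t → ¬ S (pow β t x)
    orbit-avoids t St with cases St | orbit-fix t
    ... | inj₁ eq        | fx = a-moves (subst (λ y → pow β s y ≡ y) eq fx)
    ... | inj₂ (inj₁ eq) | fx = b-moves (subst (λ y → pow β s y ≡ y) eq fx)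
    ... | inj₂ (inj₂ eq) | fx = c-moves (subst (λ y → pow β s y ≡ y) eq fx)
    same : ∀ t → pow γ t x ≡ pow β t x
    same zero    = refl
    same (suc t) = trans (cong γ (same t)) (off (orbit-avoids t))

conjugate-injective : {β γ : Fin n → Fin n} → Conjugate β γ → Injective β → Injective γ
conjugate-injective κ inj {x} {y} eq
  with injective⇒surjective _ (Conjugate.conj-injective κ) x
     | injective⇒surjective _ (Conjugate.conj-injective κ) y
... | u , refl | v , refl = cong conj (inj (conj-injective (trans (intertwines u) (trans eq (sym (intertwines v))))))
  where open Conjugate κ

data Shape (β : A → A) (S : A → Set) (a b c : A) : Set where
  oneCycle : ∀ {p q r} → FirstReturn β S p a b → FirstReturn β S q b c → FirstReturn β S r c a → Shape β S a b c
  twoCycles : ∀ {s} → FirstReturn β S s a c → FirstReturn β S s b b → Shape β S a b c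

module _ {S : Fin n → Set} {β γ : Fin n → Fin n} (inj : Injective β) (κ : Conjugate β γ) where

  -- By `twist-fixed`, `pow β s` fixes `b`. An arc from `b` to `a` would make it fix `a` too,
  -- although it sends `a` to `c`; an arc from `b` to `c` is impossible since the arc of `a` ends
  -- there. So `b` is alone on its cycle, of length `m` at most `s`. Equality comes from
  -- `twist-fixed` for `γ`, where `a` reaches `b` in `m` steps while `c` is alone on a cycle of
  -- length `s`.
  other-cycle : ∀ {a b c s} → Twist S β γ a b c → FirstReturn β S s a c → FirstReturn β S s b b
  other-cycle {a} {b} {c} {s} w r with firstReturn-exists inj (twist-dec w) (Twist.Sb w)
  ... | m , y , r′ with Twist.cases w (Return.target r′)
  ... | inj₁ refl = contradiction (trans (sym (Return.arrives r)) a-fixed) (Twist.c≢a w)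
    where
    open ≡-Reasoning
    a-fixed : pow β s a ≡ a
    a-fixed = begin
      pow β s a            ≡⟨ cong (pow β s) (Return.arrives r′) ⟨
      pow β s (pow β m b)  ≡⟨ pow-comm β s m b ⟩
      pow β m (pow β s b)  ≡⟨ cong (pow β m) (twist-fixed inj κ w r) ⟩
      pow β m b            ≡⟨ Return.arrives r′ ⟩
      a                    ∎
  ... | inj₂ (inj₂ refl) = contradiction (firstReturn-source inj (Twist.Sa w) (Twist.Sb w) r r′) (Twist.a≢b w)
  ... | inj₂ (inj₁ refl) with <-cmp m s
  ... | tri≈ _ refl _ = r′
  ... | tri> _ _ s<m = contradiction (subst S (sym (twist-fixed inj κ w r)) (Twist.Sb w))
                         (Return.avoids r′ (Return.positive r) s<m)
  ... | tri< m<s _ _ = contradiction (subst S (sym c-fixed) (Twist.Sc w))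
                         (Return.avoids (twist-return w r (Twist.at-c w)) (Return.positive r′) m<s)
    where
    c-fixed : pow γ m c ≡ c
    c-fixed = twist-fixed (conjugate-injective κ inj) (conjugate-sym κ) (twist-sym w) (twist-return w r′ (Twist.at-a w))

  -- Here `γ` runs from `a` to `b` to `c`. Applied to `γ` and its arc from `b` to `c`, `twist-fixed`
  -- makes `pow γ r` fix `a`, hence also `b` on the same orbit, although it sends `b` to `c`.
  ¬three-cycles : ∀ {a b c p q r} → Twist S β γ a b c →
    FirstReturn β S p a a → FirstReturn β S q b b → FirstReturn β S r c c → ⊥
  ¬three-cycles {a} {b} {c} {p} {q} {r} w ra rb rc = Twist.b≢c w (begin
      b                    ≡⟨ Return.arrives a⇝b ⟨
      pow γ q a            ≡⟨ cong (pow γ q) a-fixed ⟨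
      pow γ q (pow γ r a)  ≡⟨ pow-comm γ q r a ⟩
      pow γ r (pow γ q a)  ≡⟨ cong (pow γ r) (Return.arrives a⇝b) ⟩
      pow γ r b            ≡⟨ Return.arrives b⇝c ⟩
      c                    ∎)
    where
    open ≡-Reasoning
    a⇝b = twist-return w rb (Twist.at-a w)
    b⇝c = twist-return w rc (Twist.at-b w)
    a-fixed : pow γ r a ≡ a
    a-fixed = twist-fixed (conjugate-injective κ inj) (conjugate-sym κ) (rotate (rotate (twist-sym w))) b⇝c

  -- One of the returns `a` to `c`, `b` to `a`, `c` to `b` yields `twoCycles` after rotation, which
  -- by `other-cycle` also disposes of the reversed 3-cycle. Otherwise each point returns to itself
  -- or to its successor; as no two arcs share an end, all three do the same.
  twist-shape : ∀ {a b c} → Twist S β γ a b c →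
    Shape β S a b c ⊎ Shape β S b c a ⊎ Shape β S c a b
  twist-shape w
    with firstReturn-exists inj (twist-dec w) (Twist.Sa w)
       | firstReturn-exists inj (twist-dec w) (Twist.Sb w)
       | firstReturn-exists inj (twist-dec w) (Twist.Sc w)
  ... | p , x , ra | q , y , rb | r , z , rc
    with Twist.cases w (Return.target ra) | Twist.cases w (Return.target rb) | Twist.cases w (Return.target rc)
  ... | inj₂ (inj₂ refl) | _ | _ = inj₁ (twoCycles ra (other-cycle w ra))
  ... | inj₁ _ | inj₁ refl | _ = inj₂ (inj₁ (twoCycles rb (other-cycle (rotate w) rb)))
  ... | inj₂ (inj₁ _) | inj₁ refl | _ = inj₂ (inj₁ (twoCycles rb (other-cycle (rotate w) rb)))
  ... | inj₁ _ | inj₂ _ | inj₂ (inj₁ refl) = inj₂ (inj₂ (twoCycles rc (other-cycle (rotate (rotate w)) rc)))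
  ... | inj₂ (inj₁ _) | inj₂ _ | inj₂ (inj₁ refl) = inj₂ (inj₂ (twoCycles rc (other-cycle (rotate (rotate w)) rc)))
  ... | inj₂ (inj₁ refl) | inj₂ (inj₁ refl) | _ =
    contradiction (firstReturn-source inj (Twist.Sa w) (Twist.Sb w) ra rb) (Twist.a≢b w)
  ... | inj₂ (inj₁ refl) | inj₂ (inj₂ refl) | inj₂ (inj₂ refl) =
    contradiction (firstReturn-source inj (Twist.Sb w) (Twist.Sc w) rb rc) (Twist.b≢c w)
  ... | inj₂ (inj₁ refl) | inj₂ (inj₂ refl) | inj₁ refl = inj₁ (oneCycle ra rb rc)
  ... | inj₁ refl | inj₂ _ | inj₁ refl =
    contradiction (firstReturn-source inj (Twist.Sc w) (Twist.Sa w) rc ra) (Twist.c≢a w)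
  ... | inj₁ refl | inj₂ (inj₂ refl) | inj₂ (inj₂ refl) =
    contradiction (firstReturn-source inj (Twist.Sb w) (Twist.Sc w) rb rc) (Twist.b≢c w)
  ... | inj₁ refl | inj₂ (inj₁ refl) | inj₂ (inj₂ refl) = ⊥-elim (¬three-cycles w ra rb rc)

-- Sufficiency: conjugators glued from orbits

-- Sends `pow f t a` to `pow g t a′` and is `h` off the orbit of `a`. Exponents below `n` reach the
-- whole orbit because no period exceeds `n`; by `transfer` the exponent found does not matter once
-- `a′` returns under `g` after the period of `a`.
glue : (f g : Fin n → Fin n) (a a′ : Fin n) (h : Fin n → Fin n) → Fin n → Fin n
glue {n} f g a a′ h x with any? (λ (t : Fin n) → pow f (toℕ t) a ≟ x)
... | yes (t , _) = pow g (toℕ t) a′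
... | no _        = h x

module _ {f : Fin n → Fin n} (inj : Injective f) {g h : Fin n → Fin n} {ℓ : ℕ} {a a′ : Fin n}
         (p : IsPeriod f ℓ a) (ret : pow g ℓ a′ ≡ a′) where

  transfer : ∀ {s t} → pow f s a ≡ pow f t a → pow g s a′ ≡ pow g t a′
  transfer {s} {t} eq with remainder (positive p) s | remainder (positive p) t
  ... | u , i , u<ℓ , refl | v , j , v<ℓ , refl
    with period-injective inj p u<ℓ v<ℓ
           (trans (sym (pow-multiple f (returns p) u i)) (trans eq (pow-multiple f (returns p) v j)))
  ... | refl = trans (pow-multiple g ret u i) (sym (pow-multiple g ret u j))

  glue-orbit : ∀ t → glue f g a a′ h (pow f t a) ≡ pow g t a′
  glue-orbit t with any? (λ (u : Fin n) → pow f (toℕ u) a ≟ pow f t a)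
  ... | yes (u , eq) = transfer {toℕ u} {t} eq
  ... | no ¬o with orbit-bounded p (t , refl)
  ... | u , u<ℓ , eq = contradiction (fromℕ< u<n , trans (cong (λ v → pow f v a) (toℕ-fromℕ< u<n)) eq) ¬o
    where
    u<n : u < n
    u<n = <-≤-trans u<ℓ (period-≤ inj p)

  glue-off : ∀ {x} → ¬ Orbit f a x → glue f g a a′ h x ≡ h x
  glue-off {x} ¬o with any? (λ (u : Fin n) → pow f (toℕ u) a ≟ x)
  ... | yes (u , eq) = contradiction (toℕ u , eq) ¬o
  ... | no _         = refl

  glue-intertwines : ∀ {x} → (¬ Orbit f a x → h (f x) ≡ g (h x)) →
    glue f g a a′ h (f x) ≡ g (glue f g a a′ h x)
  glue-intertwines {x} off with orbit? inj a x
  ... | yes (t , refl) = trans (glue-orbit (suc t)) (cong g (sym (glue-orbit t)))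
  ... | no ¬o = trans (glue-off (¬o ∘ orbit-pred inj p)) (trans (off ¬o) (cong g (sym (glue-off ¬o))))

<⊎split : ∀ {t} p → 0 < t → t ≤ p ⊎ (∃ λ u → 0 < u × t ≡ u + p)
<⊎split {t} p 0<t with t ≤? p
... | yes t≤p = inj₁ t≤p
... | no t≰p  = inj₂ (t ∸ p , m<n⇒0<n∸m (≰⇒> t≰p) , sym (m∸n+n≡m (<⇒≤ (≰⇒> t≰p))))

module _ {S : Fin n → Set} {β γ : Fin n → Fin n} {a b c : Fin n} (inj : Injective β) (w : Twist S β γ a b c) where

  open Twist w

  module _ {p q r : ℕ} (ra : FirstReturn β S p a b) (rb : FirstReturn β S q b c) (rc : FirstReturn β S r c a)
           (period : IsPeriod β (r + (q + p)) a) where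

    private
      α : Fin n → Fin n
      -- `γ` takes the arcs in the order of `b`, `a`, `c`: from `a` to `c`, on to `b`, back to `a`.
      -- The total length is unchanged, so the cycle is mapped to itself by equal exponents.
      α = glue β γ a a id

      γ-a : pow γ q a ≡ c
      γ-a = Return.arrives (twist-return w rb at-a)

      γ-p+q : pow γ (p + q) a ≡ b
      γ-p+q = trans (pow-+ γ p q a) (trans (cong (pow γ p) γ-a) (Return.arrives (twist-return w ra at-c)))

      γ-ℓ : pow γ (r + (q + p)) a ≡ a
      γ-ℓ = trans (cong (λ t → pow γ (r + t) a) (+-comm q p)) (trans (pow-+ γ r (p + q) a)
        (trans (cong (pow γ r) γ-p+q) (Return.arrives (twist-return w rc at-b))))

      α-orbit = glue-orbit inj {g = γ} {h = id} period γ-ℓ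

      -- The arcs of `a`, `b`, `c` are entered by `β` after 0, `p`, `q + p` steps from `a`, and by
      -- `γ` after `q`, 0, `p + q` steps; the preimage exponent is corrected by the difference.
      onto-orbit : ∀ t → t < r + (q + p) → ∃ λ x → α x ≡ pow β t a
      onto-orbit zero _ = a , α-orbit 0
      onto-orbit t@(suc _) t<ℓ with <⊎split {t} p z<s
      ... | inj₁ t≤p = pow β (t + q) a , trans (α-orbit (t + q)) (trans (pow-+ γ t q a)
              (trans (cong (pow γ t) γ-a) (twist-path w ra at-c z<s t≤p)))
      ... | inj₂ (u , 0<u , eq) with <⊎split q 0<u
      ... | inj₁ u≤q = pow β u a , trans (α-orbit u) (trans (twist-path w rb at-a 0<u u≤q)
              (trans (cong (pow β u) (sym (Return.arrives ra)))
              (trans (sym (pow-+ β u p a)) (cong (λ t → pow β t a) (sym eq)))))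
      ... | inj₂ (v , 0<v , refl) = pow β (v + (p + q)) a , (begin
              α (pow β (v + (p + q)) a)          ≡⟨ α-orbit (v + (p + q)) ⟩
              pow γ (v + (p + q)) a              ≡⟨ pow-+ γ v (p + q) a ⟩
              pow γ v (pow γ (p + q) a)          ≡⟨ cong (pow γ v) γ-p+q ⟩
              pow γ v b                          ≡⟨ twist-path w rc at-b 0<v v≤r ⟩
              pow β v c                          ≡⟨ cong (pow β v) (Return.arrives rb) ⟨
              pow β v (pow β q b)                ≡⟨ pow-+ β v q b ⟨
              pow β (v + q) b                    ≡⟨ cong (pow β (v + q)) (Return.arrives ra) ⟨
              pow β (v + q) (pow β p a)          ≡⟨ pow-+ β (v + q) p a ⟨
              pow β (v + q + p) a                ≡⟨ cong (λ t → pow β t a) eq ⟨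
              pow β t a                          ∎)
        where
        open ≡-Reasoning
        v≤r : v ≤ r
        v≤r = +-cancelʳ-≤ (q + p) v r (<⇒≤ (subst (_< r + (q + p)) (trans eq (+-assoc v q p)) t<ℓ))

      onto : ∀ y → ∃ λ x → α x ≡ y
      onto y with orbit? inj a y
      ... | no ¬o = y , glue-off inj period γ-ℓ ¬o
      ... | yes o with orbit-bounded period o
      ... | t , t<ℓ , refl = onto-orbit t t<ℓ

      off-orbit : ∀ {x} → ¬ Orbit β a x → ¬ S x
      off-orbit ¬o Sx with cases Sx
      ... | inj₁ refl        = ¬o (0 , refl)
      ... | inj₂ (inj₁ refl) = ¬o (p , Return.arrives ra)
      ... | inj₂ (inj₂ refl) = ¬o (orbit-trans (p , Return.arrives ra) (q , Return.arrives rb))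

    oneCycle-injective : Injective (glue β γ a a id)
    oneCycle-injective = surjective⇒injective α onto

    oneCycle-intertwines : ∀ x → glue β γ a a id (β x) ≡ γ (glue β γ a a id x)
    oneCycle-intertwines x = glue-intertwines inj period γ-ℓ λ ¬o → sym (off (off-orbit ¬o))

  module _ {s r : ℕ} (ra : FirstReturn β S s a c) (rc : FirstReturn β S r c a) (rb : FirstReturn β S s b b)
           (period-a : IsPeriod β (r + s) a) (period-b : IsPeriod β s b) (¬a⇝b : ¬ Orbit β a b) where

    private
      -- Under `γ` the arc of `a` closes up into a cycle through `c` of length `s`, the image for
      -- the cycle of `b`. The arcs of `b` and `c` form the cycle of `a`, of length `r + s` as
      -- before.
      swap-b : Fin n → Fin n
      swap-b = glue β γ b c id

      α : Fin n → Fin n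
      α = glue β γ a a swap-b

      γ-c : pow γ s c ≡ c
      γ-c = Return.arrives (twist-return w ra at-c)

      γ-a : pow γ s a ≡ b
      γ-a = Return.arrives (twist-return w rb at-a)

      γ-ℓ : pow γ (r + s) a ≡ a
      γ-ℓ = trans (pow-+ γ r s a) (trans (cong (pow γ r) γ-a) (Return.arrives (twist-return w rc at-b)))

      α-orbit = glue-orbit inj {g = γ} {h = swap-b} period-a γ-ℓ

      ¬a⇝orbit-b : ∀ t → ¬ Orbit β a (pow β t b)
      ¬a⇝orbit-b t o = ¬a⇝b (orbit-trans o (orbit-sym period-b (t , refl)))

      α-orbit-b : ∀ t → α (pow β t b) ≡ pow γ t c
      α-orbit-b t = trans (glue-off inj period-a γ-ℓ (¬a⇝orbit-b t)) (glue-orbit inj period-b γ-c t)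

      onto-orbit-a : ∀ t → t < r + s → ∃ λ x → α x ≡ pow β t a
      onto-orbit-a zero _ = a , α-orbit 0
      onto-orbit-a t@(suc _) t<ℓ with <⊎split {t} s z<s
      ... | inj₁ t≤s = pow β t b , trans (α-orbit-b t) (twist-path w ra at-c z<s t≤s)
      ... | inj₂ (u , 0<u , eq) = pow β (u + s) a , (begin
              α (pow β (u + s) a)   ≡⟨ α-orbit (u + s) ⟩
              pow γ (u + s) a       ≡⟨ pow-+ γ u s a ⟩
              pow γ u (pow γ s a)   ≡⟨ cong (pow γ u) γ-a ⟩
              pow γ u b             ≡⟨ twist-path w rc at-b 0<u u≤r ⟩
              pow β u c             ≡⟨ cong (pow β u) (Return.arrives ra) ⟨
              pow β u (pow β s a)   ≡⟨ pow-+ β u s a ⟨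
              pow β (u + s) a       ≡⟨ cong (λ t → pow β t a) eq ⟨
              pow β t a             ∎)
        where
        open ≡-Reasoning
        u≤r : u ≤ r
        u≤r = +-cancelʳ-≤ s u r (<⇒≤ (subst (_< r + s) eq t<ℓ))

      onto-orbit-b : ∀ t → t < s → ∃ λ x → α x ≡ pow β t b
      -- As the end of the arc that `γ` follows from `a`, `b` has exponent `s` there and not 0.
      onto-orbit-b zero _ = pow β s a , trans (α-orbit s) γ-a
      onto-orbit-b t@(suc _) t<s = pow β t a , trans (α-orbit t) (twist-path w rb at-a z<s (<⇒≤ t<s))

      onto : ∀ y → ∃ λ x → α x ≡ y
      onto y with orbit? inj a y | orbit? inj b y
      ... | no ¬a⇝y | no ¬b⇝y = y , trans (glue-off inj period-a γ-ℓ ¬a⇝y) (glue-off inj period-b γ-c ¬b⇝y)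
      ... | yes o | _ with orbit-bounded period-a o
      ... | t , t<ℓ , refl = onto-orbit-a t t<ℓ
      onto y | no _ | yes o with orbit-bounded period-b o
      ... | t , t<s , refl = onto-orbit-b t t<s

      off-orbits : ∀ {x} → ¬ Orbit β a x → ¬ Orbit β b x → ¬ S x
      off-orbits ¬a⇝x ¬b⇝x Sx with cases Sx
      ... | inj₁ refl        = ¬a⇝x (0 , refl)
      ... | inj₂ (inj₁ refl) = ¬b⇝x (0 , refl)
      ... | inj₂ (inj₂ refl) = ¬a⇝x (s , Return.arrives ra)

    twoCycles-injective : Injective (glue β γ a a (glue β γ b c id))
    twoCycles-injective = surjective⇒injective α onto

    twoCycles-intertwines : ∀ x → glue β γ a a (glue β γ b c id) (β x) ≡ γ (glue β γ a a (glue β γ b c id) x)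
    twoCycles-intertwines x = glue-intertwines inj period-a γ-ℓ λ ¬a⇝x →
      glue-intertwines inj period-b γ-c λ ¬b⇝x → sym (off (off-orbits ¬a⇝x ¬b⇝x))

-- Cycle counts through periods and least elements

iter≡pow : (β : Map n) → ∀ k a → iter β k a ≡ pow (lookup β) k a
iter≡pow β zero    a = refl
iter≡pow β (suc k) a = cong (lookup β) (iter≡pow β k a)

-- The functions allBelow and minBelow are local to Defs and have no name here: the unifier recovers them from the
-- unfolded definitions.  Abstracting suc k in the where-parameter separates it from the recursion argument k.
mutual
  noReturnBelow : Map n → Fin n → ℕ → ℕ → Bool
  noReturnBelow = _

  onCycleOfLength-suc : (β : Map n) (k : ℕ) (a : Fin n) → onCycleOfLength β (suc k) a ≡
    ((1 <ᵇ suc k + 1) ∧ (iter β (suc k) a == a) ∧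
      (noReturnBelow β a (suc k) k ∧ ((k ≡ᵇ 0) ∨ not (iter β k a == a))))
  onCycleOfLength-suc β k a with suc k
  ... | _ = refl

mutual
  minimumBelow : Map n → Fin n → ℕ → ℕ → Bool
  minimumBelow = _

  isCycleMin-suc : (β : Map n) (k : ℕ) (a : Fin n) → isCycleMin β (suc k) a ≡
    (minimumBelow β a (suc k) k ∧ ⌊ a ≤ᶠ? iter β k a ⌋)
  isCycleMin-suc β k a with suc k
  ... | _ = refl

noReturnBelow⁻ : (β : Map n) (a : Fin n) (ℓ m : ℕ) → T (noReturnBelow β a ℓ m) →
  ∀ {t} → 0 < t → t < m → pow (lookup β) t a ≢ a
noReturnBelow⁻ β a ℓ (suc m) ok {t} 0<t (s≤s t≤m) eq with T-∧⁻ {noReturnBelow β a ℓ m} ok | m≤n⇒m<n∨m≡n t≤m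
... | below , _ | inj₁ t<m = noReturnBelow⁻ β a ℓ m below 0<t t<m eq
noReturnBelow⁻ β a ℓ (suc m@(suc _)) ok _ _ eq | _ , last | inj₂ refl =
  T-not⁻ {iter β m a == a} last (==⁺ (trans (iter≡pow β m a) eq))

noReturnBelow⁺ : (β : Map n) (a : Fin n) (ℓ m : ℕ) →
  (∀ {t} → 0 < t → t < m → pow (lookup β) t a ≢ a) → T (noReturnBelow β a ℓ m)
noReturnBelow⁺ β a ℓ zero    _  = _
noReturnBelow⁺ β a ℓ (suc m) ok =
  T-∧⁺ (noReturnBelow⁺ β a ℓ m λ 0<t t<m → ok 0<t (m<n⇒m<1+n t<m)) (last m ok)
  where
  last : ∀ m → (∀ {t} → 0 < t → t < suc m → pow (lookup β) t a ≢ a) → T ((m ≡ᵇ 0) ∨ not (iter β m a == a))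
  last zero    _  = _
  last (suc m) ok = T-not⁺ λ t →
    ok z<s ≤-refl (trans (sym (iter≡pow β (suc m) a)) (==⁻ (iter β (suc m) a) a t))

onCycle⇒period : (β : Map n) (ℓ : ℕ) {a : Fin n} → T (onCycleOfLength β ℓ a) → IsPeriod (lookup β) ℓ a
onCycle⇒period β (suc k) {a} t with T-∧⁻ {1 <ᵇ suc k + 1} t
... | _ , t′ with T-∧⁻ {iter β (suc k) a == a} t′
... | ret , below = isPeriod z<s (trans (sym (iter≡pow β (suc k) a)) (==⁻ (iter β (suc k) a) a ret))
  (noReturnBelow⁻ β a (suc k) (suc k) below)

period⇒onCycle : (β : Map n) (ℓ : ℕ) {a : Fin n} → IsPeriod (lookup β) ℓ a → T (onCycleOfLength β ℓ a)
period⇒onCycle β zero    (isPeriod () _ _)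
period⇒onCycle β (suc k) {a} p = T-∧⁺ (1<k+2 k)
  (T-∧⁺ (==⁺ (trans (iter≡pow β (suc k) a) (IsPeriod.returns p)))
        (noReturnBelow⁺ β a (suc k) (suc k) (IsPeriod.minimal p)))
  where
  1<k+2 : ∀ k → T (1 <ᵇ suc k + 1)
  1<k+2 zero    = _
  1<k+2 (suc k) = _

IsMinimum : (Fin n → Fin n) → ℕ → Fin n → Set
IsMinimum f ℓ a = ∀ {t} → t < ℓ → a ≤ᶠ pow f t a

minimumBelow⁻ : (β : Map n) (a : Fin n) (ℓ m : ℕ) → T (minimumBelow β a ℓ m) → IsMinimum (lookup β) m a
minimumBelow⁻ β a ℓ (suc m) ok (s≤s t≤m) with T-∧⁻ {minimumBelow β a ℓ m} ok | m≤n⇒m<n∨m≡n t≤m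
... | below , _ | inj₁ t<m  = minimumBelow⁻ β a ℓ m below t<m
... | _ , last  | inj₂ refl = subst (a ≤ᶠ_) (iter≡pow β m a) (toWitness last)

minimumBelow⁺ : (β : Map n) (a : Fin n) (ℓ m : ℕ) → IsMinimum (lookup β) m a → T (minimumBelow β a ℓ m)
minimumBelow⁺ β a ℓ zero    _   = _
minimumBelow⁺ β a ℓ (suc m) min = T-∧⁺ (minimumBelow⁺ β a ℓ m λ t<m → min (m<n⇒m<1+n t<m))
  (fromWitness {a? = a ≤ᶠ? iter β m a} (subst (a ≤ᶠ_) (sym (iter≡pow β m a)) (min ≤-refl)))

minimum-exists : {f : Fin n → Fin n} → Injective f → ∀ {ℓ x} → IsPeriod f ℓ x →
  ∃ λ z → IsPeriod f ℓ z × IsMinimum f ℓ z × Orbit f z x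
minimum-exists {f = f} inj {suc ℓ} {x} p
  with least {P = λ k → ∃ λ (t : Fin (suc ℓ)) → toℕ (pow f (toℕ t) x) ≡ k}
         (λ k → any? λ t → toℕ (pow f (toℕ t) x) ≟ⁿ k) (zero , refl)
... | _ , (t , refl) , _ , min = z , orbit-period inj p x⇝z , minimum , orbit-sym p x⇝z
  where
  z = pow f (toℕ t) x
  x⇝z : Orbit f x z
  x⇝z = toℕ t , refl
  minimum : IsMinimum f (suc ℓ) z
  minimum {u} _ with orbit-bounded p (orbit-trans x⇝z (u , refl))
  ... | v , v<ℓ , eq = ≮⇒≥ λ smaller → min smaller (fromℕ< v<ℓ ,
          cong toℕ (trans (cong (λ s → pow f s x) (toℕ-fromℕ< v<ℓ)) eq))

minimum-unique : {f : Fin n → Fin n} → ∀ {ℓ y z} → IsPeriod f ℓ y → IsPeriod f ℓ z →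
  IsMinimum f ℓ y → IsMinimum f ℓ z → Orbit f y z → y ≡ z
minimum-unique py pz min-y min-z o with orbit-bounded py o | orbit-bounded pz (orbit-sym py o)
... | s , s<ℓ , y⇝z | t , t<ℓ , z⇝y =
  ≤ᶠ-antisym (subst (_ ≤ᶠ_) y⇝z (min-y s<ℓ)) (subst (_ ≤ᶠ_) z⇝y (min-z t<ℓ))

points minima : Map n → ℕ → List (Fin n)
points β ℓ = satisfying (onCycleOfLength β ℓ)
minima β ℓ = satisfying λ a → onCycleOfLength β ℓ a ∧ isCycleMin β ℓ a

∈-minima⁺ : (β : Map n) → ∀ {ℓ z} → IsPeriod (lookup β) ℓ z → IsMinimum (lookup β) ℓ z → z ∈ minima β ℓ
∈-minima⁺ β {ℓ} {z} p min = ∈-satisfying⁺ _ (T-∧⁺ (period⇒onCycle β ℓ p) (minimumBelow⁺ β z ℓ ℓ min))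

∈-minima⁻ : (β : Map n) → ∀ ℓ {z} → z ∈ minima β ℓ → IsPeriod (lookup β) ℓ z × IsMinimum (lookup β) ℓ z
∈-minima⁻ β ℓ {z} z∈ with T-∧⁻ {onCycleOfLength β ℓ z} (∈-satisfying⁻ _ z∈)
... | on , min = onCycle⇒period β ℓ on , minimumBelow⁻ β z ℓ ℓ min

∈-points⁺ : (β : Map n) → ∀ {ℓ a} → IsPeriod (lookup β) ℓ a → a ∈ points β ℓ
∈-points⁺ β {ℓ} p = ∈-satisfying⁺ _ (period⇒onCycle β ℓ p)

∈-points⁻ : (β : Map n) → ∀ ℓ {a} → a ∈ points β ℓ → IsPeriod (lookup β) ℓ a
∈-points⁻ β ℓ a∈ = onCycle⇒period β ℓ (∈-satisfying⁻ _ a∈)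

length-minima : (β : Map n) → ∀ ℓ → length (minima β ℓ) ≡ cycleCount β ℓ
length-minima β ℓ = sym (countF≡length (λ a → onCycleOfLength β ℓ a ∧ isCycleMin β ℓ a))

-- Each point of a cycle is `pow f i z` for the least element `z` of that cycle and exactly one `i`
-- below `ℓ`.
length-points : (β : Map n) → Injective (lookup β) → ∀ ℓ → length (points β ℓ) ≡ cycleCount β ℓ * ℓ
length-points β inj ℓ = begin
    length (points β ℓ)                        ≡⟨ pairs≡points ⟨
    length pairs                               ≡⟨ length-sigma-const (minima β ℓ) (upTo ℓ) ⟩
    length (minima β ℓ) * length (upTo ℓ)      ≡⟨ cong₂ _*_ (length-minima β ℓ) (length-upTo ℓ) ⟩
    cycleCount β ℓ * ℓ                         ∎
  where
  open ≡-Reasoning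
  f = lookup β
  pairs = sigma (minima β ℓ) λ _ → upTo ℓ
  coordinates : Fin _ × ℕ → Fin _
  coordinates (z , i) = pow f i z
  split : ∀ {x} → x ∈ pairs → (IsPeriod f ℓ (proj₁ x) × IsMinimum f ℓ (proj₁ x)) × proj₂ x < ℓ
  split x∈ with ∈-sigma⁻ (minima β ℓ) (λ _ → upTo ℓ) x∈
  ... | z∈ , i∈ = ∈-minima⁻ β ℓ z∈ , ∈-upTo⁻ i∈
  coordinates-injective : ∀ {x y} → x ∈ pairs → y ∈ pairs → coordinates x ≡ coordinates y → x ≡ y
  coordinates-injective {z , i} {z′ , i′} x∈ y∈ eq with split x∈ | split y∈
  ... | (p , min) , i<ℓ | (p′ , min′) , i′<ℓ
    with minimum-unique p p′ min min′ (orbit-trans (i , eq) (orbit-sym p′ (i′ , refl)))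
  ... | refl with period-injective inj p i<ℓ i′<ℓ eq
  ... | refl = refl
  into : ∀ {x} → x ∈ pairs → coordinates x ∈ points β ℓ
  into {z , i} x∈ = ∈-points⁺ β (period-pow inj i (proj₁ (proj₁ (split x∈))))
  onto : ∀ {y} → y ∈ points β ℓ → ∃ λ x → x ∈ pairs × y ≡ coordinates x
  onto y∈ with minimum-exists inj (∈-points⁻ β ℓ y∈)
  ... | z , p , min , o with orbit-bounded p o
  ... | i , i<ℓ , refl = (z , i) , ∈-sigma⁺ (∈-minima⁺ β p min) (∈-upTo⁺ i<ℓ) , refl
  pairs≡points : length pairs ≡ length (points β ℓ)
  pairs≡points = bijection⇒length≡ coordinates
    (Unique-sigma {f = λ _ → upTo ℓ} (Unique-satisfying _) (λ _ → upTo⁺ ℓ)) (Unique-satisfying _)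
    coordinates-injective into onto

-- Existence and uniqueness of the 3-cycle of a twist

firstReturn-orbit : {f : A → A} {S : A → Set} → ∀ {s x y} → FirstReturn f S s x y → Orbit f x y
firstReturn-orbit {s = s} r = s , Return.arrives r

OneOf : A → A → A → A → Set
OneOf a b c y = y ≡ a ⊎ y ≡ b ⊎ y ≡ c

twist : (Fin n → Fin n) → (a b c : Fin n) → Fin n → Fin n
twist β a b c y with y ≟ a | y ≟ b | y ≟ c
... | yes _ | _     | _     = β b
... | no _  | yes _ | _     = β c
... | no _  | no _  | yes _ = β a
... | no _  | no _  | no _  = β y

twist-is-twist : (β : Fin n → Fin n) → ∀ {a b c} → a ≢ b → b ≢ c → c ≢ a →
  Twist (OneOf a b c) β (twist β a b c) a b c
twist-is-twist β {a} {b} {c} a≢b b≢c c≢a = record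
  { a≢b = a≢b ; b≢c = b≢c ; c≢a = c≢a
  ; Sa = inj₁ refl ; Sb = inj₂ (inj₁ refl) ; Sc = inj₂ (inj₂ refl) ; cases = id
  ; at-a = at-a ; at-b = at-b ; at-c = at-c ; off = off }
  where
  at-a : twist β a b c a ≡ β b
  at-a with a ≟ a | a ≟ b | a ≟ c
  ... | yes _ | _ | _ = refl
  ... | no ne | _ | _ = contradiction refl ne
  at-b : twist β a b c b ≡ β c
  at-b with b ≟ a | b ≟ b | b ≟ c
  ... | yes eq | _     | _ = contradiction (sym eq) a≢b
  ... | no _   | yes _ | _ = refl
  ... | no _   | no ne | _ = contradiction refl ne
  at-c : twist β a b c c ≡ β a
  at-c with c ≟ a | c ≟ b | c ≟ c
  ... | yes eq | _      | _     = contradiction eq c≢a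
  ... | no _   | yes eq | _     = contradiction (sym eq) b≢c
  ... | no _   | no _   | yes _ = refl
  ... | no _   | no _   | no ne = contradiction refl ne
  off : ∀ {y} → ¬ OneOf a b c y → twist β a b c y ≡ β y
  off {y} y∉ with y ≟ a | y ≟ b | y ≟ c
  ... | yes eq | _      | _      = contradiction (inj₁ eq) y∉
  ... | no _   | yes eq | _      = contradiction (inj₂ (inj₁ eq)) y∉
  ... | no _   | no _   | yes eq = contradiction (inj₂ (inj₂ eq)) y∉
  ... | no _   | no _   | no _   = refl

twist-moves : {S : A → Set} {β γ : A → A} → Injective β → ∀ {a b c} → Twist S β γ a b c →
  ∀ {y} → S y → γ y ≢ β y
twist-moves inj w Sy with Twist.cases w Sy
... | inj₁ refl        = λ eq → Twist.a≢b w (inj (trans (sym eq) (Twist.at-a w)))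
... | inj₂ (inj₁ refl) = λ eq → Twist.b≢c w (inj (trans (sym eq) (Twist.at-b w)))
... | inj₂ (inj₂ refl) = λ eq → Twist.c≢a w (inj (trans (sym eq) (Twist.at-c w)))

twist-determined : {S S′ : Fin n → Set} {β γ γ′ : Fin n → Fin n} → ∀ {a b c} →
  Twist S β γ a b c → Twist S′ β γ′ a b c → ∀ y → γ y ≡ γ′ y
twist-determined {S = S} {S′} w w′ y with twist-dec w y
... | no ¬Sy = trans (Twist.off w ¬Sy) (sym (Twist.off w′ (¬Sy ∘ S′⇒S)))
  where
  S′⇒S : S′ y → S y
  S′⇒S S′y with Twist.cases w′ S′y
  ... | inj₁ refl        = Twist.Sa w
  ... | inj₂ (inj₁ refl) = Twist.Sb w
  ... | inj₂ (inj₂ refl) = Twist.Sc w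
... | yes Sy with Twist.cases w Sy
... | inj₁ refl        = trans (Twist.at-a w) (sym (Twist.at-a w′))
... | inj₂ (inj₁ refl) = trans (Twist.at-b w) (sym (Twist.at-b w′))
... | inj₂ (inj₂ refl) = trans (Twist.at-c w) (sym (Twist.at-c w′))

-- `S` is exactly where `γ` differs from `β`, so `a′` is one of `a`, `b`, `c`. From there
-- `γ a′ ≡ β b′` and `γ b′ ≡ β c′` determine the other two entries.
twist-unique : {S S′ : Fin n → Set} {β γ γ′ : Fin n → Fin n} → Injective β → (∀ y → γ y ≡ γ′ y) →
  ∀ {a b c a′ b′ c′} → Twist S β γ a b c → Twist S′ β γ′ a′ b′ c′ →
  (a , b , c) ≡ (a′ , b′ , c′) ⊎ (b , c , a) ≡ (a′ , b′ , c′) ⊎ (c , a , b) ≡ (a′ , b′ , c′)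
twist-unique {S = S} {S′} {β} {γ} {γ′} inj γ≡γ′ {a′ = a′} {b′} {c′} w w′ with twist-dec w a′
... | no ¬Sa′ = contradiction (trans (sym (γ≡γ′ a′)) (Twist.off w ¬Sa′)) (twist-moves inj w′ (Twist.Sa w′))
... | yes Sa′ = by-first (Twist.cases w Sa′)
  where
  follow : ∀ {a b c} → a ≡ a′ → Twist S β γ a b c → (a , b , c) ≡ (a′ , b′ , c′)
  follow refl v with inj (trans (sym (Twist.at-a v)) (trans (γ≡γ′ _) (Twist.at-a w′)))
  ... | refl with inj (trans (sym (Twist.at-b v)) (trans (γ≡γ′ _) (Twist.at-b w′)))
  ... | refl = refl
  by-first : a′ ≡ _ ⊎ a′ ≡ _ ⊎ a′ ≡ _ → _
  by-first (inj₁ eq)        = inj₁ (follow (sym eq) w)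
  by-first (inj₂ (inj₁ eq)) = inj₂ (inj₁ (follow (sym eq) (rotate w)))
  by-first (inj₂ (inj₂ eq)) = inj₂ (inj₂ (follow (sym eq) (rotate (rotate w))))

-- Agreement elsewhere forces `γ` to map {a, b, c} onto its image under `β`. So `β` inverse after
-- `γ` permutes three points without fixed point, and only two permutations do.
twist-exists : {β γ : Fin n → Fin n} → Injective β → Injective γ → ∀ {a b c} → a ≢ b → b ≢ c → c ≢ a →
  (∀ {y} → OneOf a b c y → γ y ≢ β y) → (∀ {y} → ¬ OneOf a b c y → γ y ≡ β y) →
  Twist (OneOf a b c) β γ a b c ⊎ Twist (OneOf a b c) β γ a c b
twist-exists {β = β} {γ} β-inj γ-inj {a} {b} {c} a≢b b≢c c≢a moved off
  with permuted (inj₁ refl) | permuted (inj₂ (inj₁ refl)) | permuted (inj₂ (inj₂ refl))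
  where
  permuted : ∀ {x} → OneOf a b c x → OneOf (β a) (β b) (β c) (γ x)
  permuted {x} x∈ with injective⇒surjective β β-inj (γ x)
  ... | y , βy≡γx with y ≟ a | y ≟ b | y ≟ c
  ... | yes refl | _ | _ = inj₁ (sym βy≡γx)
  ... | _ | yes refl | _ = inj₂ (inj₁ (sym βy≡γx))
  ... | _ | _ | yes refl = inj₂ (inj₂ (sym βy≡γx))
  ... | no y≢a | no y≢b | no y≢c
    with γ-inj (trans (off {y} [ y≢a , [ y≢b , y≢c ] ]) βy≡γx)
  ... | refl = contradiction x∈ [ y≢a , [ y≢b , y≢c ] ]
... | inj₁ aa | _ | _ = contradiction aa (moved (inj₁ refl))
... | _ | inj₂ (inj₁ bb) | _ = contradiction bb (moved (inj₂ (inj₁ refl)))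
... | _ | _ | inj₂ (inj₂ cc) = contradiction cc (moved (inj₂ (inj₂ refl)))
... | inj₂ (inj₁ ab) | inj₁ ba | inj₁ ca = contradiction (γ-inj (trans ba (sym ca))) b≢c
... | inj₂ (inj₁ ab) | _ | inj₂ (inj₁ cb) = contradiction (γ-inj (trans cb (sym ab))) c≢a
... | inj₂ (inj₂ ac) | inj₂ (inj₂ bc) | _ = contradiction (γ-inj (trans ac (sym bc))) a≢b
... | inj₂ (inj₂ ac) | inj₁ ba | inj₁ ca = contradiction (γ-inj (trans ba (sym ca))) b≢c
... | inj₂ (inj₁ ab) | inj₂ (inj₂ bc) | inj₁ ca = inj₁ record
  { a≢b = a≢b ; b≢c = b≢c ; c≢a = c≢a
  ; Sa = inj₁ refl ; Sb = inj₂ (inj₁ refl) ; Sc = inj₂ (inj₂ refl) ; cases = id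
  ; at-a = ab ; at-b = bc ; at-c = ca ; off = off }
... | inj₂ (inj₂ ac) | inj₁ ba | inj₂ (inj₁ cb) = inj₂ record
  { a≢b = c≢a ∘ sym ; b≢c = b≢c ∘ sym ; c≢a = a≢b ∘ sym
  ; Sa = inj₁ refl ; Sb = inj₂ (inj₂ refl) ; Sc = inj₂ (inj₁ refl)
  ; cases = λ { (inj₁ p) → inj₁ p ; (inj₂ (inj₁ p)) → inj₂ (inj₂ p) ; (inj₂ (inj₂ p)) → inj₂ (inj₁ p) }
  ; at-a = ac ; at-b = cb ; at-c = ba ; off = off }

-- Conjugators for both kinds of 3-cycles, and positions on a cycle

<⇒+ : ∀ {i j} → i < j → ∃ λ p → 0 < p × j ≡ p + i
<⇒+ {i} {j} i<j = j ∸ i , m<n⇒0<n∸m i<j , sym (m∸n+n≡m (<⇒≤ i<j))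

-- αβα⁻¹ = β ∘ (a b c); the twist β a b c is β ∘ (a b c) only for distinct a, b, c.
record Solution (β : Fin n → Fin n) (a b c : Fin n) (α : Fin n → Fin n) : Set where
  field
    isTwist : Twist (OneOf a b c) β (twist β a b c) a b c
    injective : Injective α
    intertwines : ∀ x → α (β x) ≡ twist β a b c (α x)

module _ {β : Fin n → Fin n} (inj : Injective β) where

  -- With `a` at index 0, indices below the period determine points, so every condition on the arcs
  -- becomes an inequality between indices.
  oneCycle-solution-base : ∀ {a p q r} → 0 < p → 0 < q → 0 < r → IsPeriod β (r + (q + p)) a →
    let b = pow β p a ; c = pow β (q + p) a in Solution β a b c (glue β (twist β a b c) a a id)
  oneCycle-solution-base {a} {p} {q} {r} 0<p 0<q 0<r period = record
    { isTwist = w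
    ; injective = oneCycle-injective inj w ra rb rc period
    ; intertwines = oneCycle-intertwines inj w ra rb rc period }
    where
    b c : Fin n
    b = pow β p a
    c = pow β (q + p) a
    p<q+p : p < q + p
    p<q+p = m<n+m p 0<q
    q+p<ℓ : q + p < r + (q + p)
    q+p<ℓ = m<n+m (q + p) 0<r
    -- The index is split as `t + u` because the arcs of `rb` and `rc` start at the indices `p` and
    -- `q + p`.
    skip : ∀ t u → 0 < t + u → t + u < r + (q + p) → t + u ≢ p → t + u ≢ q + p → ¬ OneOf a b c (pow β t (pow β u a))
    skip t u 0<t+u t+u<ℓ ≢p ≢q+p =
      [ IsPeriod.minimal period 0<t+u t+u<ℓ ∘ trans (pow-+ β t u a)
      , [ ≢p ∘ index (<-trans p<q+p q+p<ℓ) , ≢q+p ∘ index q+p<ℓ ] ]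
      where
      index : ∀ {v} → v < r + (q + p) → pow β t (pow β u a) ≡ pow β v a → t + u ≡ v
      index v<ℓ eq = period-injective inj period t+u<ℓ v<ℓ (trans (pow-+ β t u a) eq)
    w : Twist (OneOf a b c) β (twist β a b c) a b c
    w = twist-is-twist β
      (IsPeriod.minimal period 0<p (<-trans p<q+p q+p<ℓ) ∘ sym)
      (λ eq → <⇒≢ p<q+p (period-injective inj period (<-trans p<q+p q+p<ℓ) q+p<ℓ eq))
      (IsPeriod.minimal period (<-trans 0<p p<q+p) q+p<ℓ)
    ra : FirstReturn β (OneOf a b c) p a b
    ra = firstReturn 0<p refl (Twist.Sb w) λ {t} 0<t t<p →
      let t<q+p = <-trans t<p p<q+p in
      skip 0 t 0<t (<-trans t<q+p q+p<ℓ) (<⇒≢ t<p) (<⇒≢ t<q+p)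
    rb : FirstReturn β (OneOf a b c) q b c
    rb = firstReturn 0<q (sym (pow-+ β q p a)) (Twist.Sc w) λ {t} 0<t t<q →
      let t+p<q+p = +-monoˡ-< p t<q in
      skip t p (<-≤-trans 0<t (m≤m+n t p)) (<-trans t+p<q+p q+p<ℓ) (<⇒≢ (m<n+m p 0<t) ∘ sym) (<⇒≢ t+p<q+p)
    rc : FirstReturn β (OneOf a b c) r c a
    rc = firstReturn 0<r (trans (sym (pow-+ β r (q + p) a)) (IsPeriod.returns period)) (Twist.Sa w) λ {t} 0<t t<r →
      let q+p<t+q+p = m<n+m (q + p) 0<t in
      skip t (q + p) (<-≤-trans 0<t (m≤m+n t (q + p))) (+-monoˡ-< (q + p) t<r)
        (<⇒≢ (<-trans p<q+p q+p<t+q+p) ∘ sym) (<⇒≢ q+p<t+q+p ∘ sym)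

  oneCycle-solution : ∀ {z ℓ i j k} → IsPeriod β ℓ z → i < j → j < k → k < ℓ →
    let a = pow β i z ; b = pow β j z ; c = pow β k z in Solution β a b c (glue β (twist β a b c) a a id)
  oneCycle-solution {z} {i = i} period i<j j<k k<ℓ with <⇒+ i<j | <⇒+ j<k | <⇒+ k<ℓ
  ... | p , 0<p , refl | q , 0<q , refl | r , 0<r , refl =
    subst₂ (λ b c → Solution β a b c (glue β (twist β a b c) a a id)) (sym (pow-+ β p i z))
      (trans (sym (pow-+ β (q + p) i z)) (cong (λ t → pow β t z) (+-assoc q p i)))
      -- Seen from `pow β i z`, the last arc runs on through `z` up to index `i`, so its length is
      -- `r + i`.
      (oneCycle-solution-base 0<p 0<q (<-≤-trans 0<r (m≤m+n r i))
        (subst (λ ℓ → IsPeriod β ℓ a) lengths (period-pow inj i period)))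
    where
    a = pow β i z
    open ≡-Reasoning
    lengths : r + (q + (p + i)) ≡ r + i + (q + p)
    lengths = begin
      r + (q + (p + i))  ≡⟨ cong (r +_) (+-assoc q p i) ⟨
      r + (q + p + i)    ≡⟨ cong (r +_) (+-comm (q + p) i) ⟩
      r + (i + (q + p))  ≡⟨ +-assoc r i (q + p) ⟨
      r + i + (q + p)    ∎

  separate-orbits : ∀ {a b s m} → s < m → IsPeriod β s b → IsPeriod β m a → ¬ Orbit β a b
  separate-orbits s<m period-b period-a o = <⇒≢ s<m (period-unique period-b (orbit-period inj period-a o))

  -- `s < m` separates `pow β s a` from `a` and leaves an arc of length m - s back to `a`; the
  -- unequal periods keep `b` off the cycle of `a`.
  twoCycles-solution : ∀ {a b s m} → s < m → IsPeriod β s b → IsPeriod β m a →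
    let c = pow β s a ; γ = twist β a b c in Solution β a b c (glue β γ a a (glue β γ b c id))
  twoCycles-solution {a} {b} {s} s<m period-b period-a with <⇒+ s<m
  ... | r , 0<r , refl = record
    { isTwist = w
    ; injective = twoCycles-injective inj w ra rc rb period-a period-b ¬a⇝b
    ; intertwines = twoCycles-intertwines inj w ra rc rb period-a period-b ¬a⇝b }
    where
    c : Fin n
    c = pow β s a
    0<s : 0 < s
    0<s = IsPeriod.positive period-b
    ¬a⇝b : ¬ Orbit β a b
    ¬a⇝b = separate-orbits s<m period-b period-a
    ¬b⇝c : ¬ Orbit β b c
    ¬b⇝c o = ¬a⇝b (orbit-trans (s , refl) (orbit-sym period-b o))
    w : Twist (OneOf a b c) β (twist β a b c) a b c
    w = twist-is-twist β (λ eq → ¬a⇝b (0 , eq)) (λ eq → ¬b⇝c (0 , eq)) (IsPeriod.minimal period-a 0<s s<m)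
    ra : FirstReturn β (OneOf a b c) s a c
    ra = firstReturn 0<s refl (Twist.Sc w) λ {t} 0<t t<s →
      [ IsPeriod.minimal period-a 0<t (<-trans t<s s<m)
      , [ (λ eq → ¬a⇝b (t , eq)) , <⇒≢ t<s ∘ period-injective inj period-a (<-trans t<s s<m) s<m ] ]
    rc : FirstReturn β (OneOf a b c) r c a
    rc = firstReturn 0<r (trans (sym (pow-+ β r s a)) (IsPeriod.returns period-a)) (Twist.Sa w) λ {t} 0<t t<r →
      [ IsPeriod.minimal period-a (<-≤-trans 0<t (m≤m+n t s)) (+-monoˡ-< s t<r) ∘ trans (pow-+ β t s a)
      , [ (λ eq → ¬a⇝b (orbit-trans (s , refl) (t , eq)))
        , <⇒≢ (m<n+m s 0<t) ∘ sym ∘ period-injective inj period-a (+-monoˡ-< s t<r) s<m ∘ trans (pow-+ β t s a) ] ]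
    rb : FirstReturn β (OneOf a b c) s b b
    rb = firstReturn 0<s (IsPeriod.returns period-b) (Twist.Sb w) λ {t} 0<t t<s →
      [ (λ eq → ¬a⇝b (orbit-sym period-b (t , eq)))
      , [ IsPeriod.minimal period-b 0<t t<s , (λ eq → ¬b⇝c (t , eq)) ] ]

  module _ {z ℓ} (period : IsPeriod β ℓ z) {S : Fin n → Set} where

    -- The arc from index `i` cannot pass index `k`, where it meets `S`. So it ends before wrapping
    -- around at `z`, and its end has index `p + i`.
    next-position : ∀ {i j k p} → FirstReturn β S p (pow β i z) (pow β j z) → S (pow β k z) →
      pow β j z ≢ pow β k z → i < k → j < ℓ → k < ℓ → j < k
    next-position {i} {j} {k} {p} ret Sk j≢k i<k j<ℓ k<ℓ with <-cmp j k
    ... | tri< j<k _ _  = j<k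
    ... | tri≈ _ refl _ = contradiction refl j≢k
    ... | tri> _ _ k<j with <⇒+ i<k
    ... | t , 0<t , refl with <-cmp p t
    ... | tri> _ _ t<p  = contradiction (subst S (pow-+ β t i z) Sk) (Return.avoids ret 0<t t<p)
    ... | tri≈ _ refl _ = contradiction (trans (sym (Return.arrives ret)) (sym (pow-+ β p i z))) j≢k
    ... | tri< p<t _ _  = contradiction (<-trans k<j j<t+i) (<-irrefl refl)
      where
      p+i<t+i : p + i < t + i
      p+i<t+i = +-monoˡ-< i p<t
      j<t+i : j < t + i
      j<t+i = subst (_< t + i) (period-injective inj period (<-trans p+i<t+i k<ℓ) j<ℓ
        (trans (pow-+ β p i z) (Return.arrives ret))) p+i<t+i

    increasing-positions : ∀ {γ a b c p q r} → Twist S β γ a b c →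
      FirstReturn β S p a b → FirstReturn β S q b c → FirstReturn β S r c a → Orbit β z a →
      ∃ λ i → ∃ λ j → ∃ λ k → i < j × j < k × k < ℓ × Twist S β γ (pow β i z) (pow β j z) (pow β k z)
    increasing-positions w ra rb rc z⇝a
      with orbit-bounded period z⇝a
         | orbit-bounded period (orbit-trans z⇝a (firstReturn-orbit ra))
         | orbit-bounded period (orbit-trans z⇝a (orbit-trans (firstReturn-orbit ra) (firstReturn-orbit rb)))
    ... | i , i<ℓ , refl | j , j<ℓ , refl | k , k<ℓ , refl with <-cmp i j | <-cmp j k | <-cmp k i
    ... | tri≈ _ refl _ | _ | _ = contradiction refl (Twist.a≢b w)
    ... | _ | tri≈ _ refl _ | _ = contradiction refl (Twist.b≢c w)
    ... | _ | _ | tri≈ _ refl _ = contradiction refl (Twist.c≢a w)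
    -- The rotation is the one starting at the smallest index; `next-position` then orders the other
    -- two.
    ... | tri< i<j _ _ | _ | tri> _ _ i<k =
      i , j , k , i<j , next-position ra (Twist.Sc w) (Twist.b≢c w) i<k j<ℓ k<ℓ , k<ℓ , w
    ... | tri> _ _ j<i | tri< j<k _ _ | _ =
      j , k , i , j<k , next-position rb (Twist.Sa w) (Twist.c≢a w) j<i k<ℓ i<ℓ , i<ℓ , rotate w
    ... | _ | tri> _ _ k<j | tri< k<i _ _ =
      k , i , j , k<i , next-position rc (Twist.Sb w) (Twist.a≢b w) k<j i<ℓ j<ℓ , j<ℓ , rotate (rotate w)
    ... | tri< i<j _ _ | tri< j<k _ _ | tri< k<i _ _ = contradiction (<-trans i<j (<-trans j<k k<i)) (<-irrefl refl)
    ... | tri> _ _ j<i | tri> _ _ k<j | tri> _ _ i<k = contradiction (<-trans i<k (<-trans k<j j<i)) (<-irrefl refl)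

-- inj₁ (ℓ , z , k , j , i): a cycle of length ℓ with least element z, and the points βⁱz, βʲz, βᵏz on it, i < j < k.
-- inj₂ (s , m , b , a): points b, a on cycles of lengths s < m.
Parameter : ℕ → Set
Parameter n = (ℕ × Fin n × ℕ × ℕ × ℕ) ⊎ (ℕ × ℕ × Fin n × Fin n)

-- The parameters: one for each admissible 3-cycle

module _ (β : Map n) where

  private
    f = lookup β

  sameCycle : List (ℕ × Fin n × ℕ × ℕ × ℕ)
  sameCycle = sigma (range 3 n) λ ℓ → sigma (minima β ℓ) λ _ → triples ℓ

  differentCycles : List (ℕ × ℕ × Fin n × Fin n)
  differentCycles = sigma (range 1 n) λ s → sigma (range (suc s) n) λ m → sigma (points β s) λ _ → points β m

  parameters : List (Parameter n)
  parameters = map inj₁ sameCycle ++ map inj₂ differentCycles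

  Valid : Parameter n → Set
  Valid (inj₁ (ℓ , z , k , j , i)) = IsPeriod f ℓ z × IsMinimum f ℓ z × i < j × j < k × k < ℓ
  Valid (inj₂ (s , m , b , a)) = s < m × IsPeriod f s b × IsPeriod f m a

  Unique-parameters : Unique parameters
  Unique-parameters = Unique-++⁺
    (Unique-map⁺ (λ { refl → refl })
      (Unique-sigma (Unique-range 3 n) λ {ℓ} _ → Unique-sigma (Unique-satisfying _) λ _ → Unique-triples ℓ))
    (Unique-map⁺ (λ { refl → refl })
      (Unique-sigma (Unique-range 1 n) λ {s} _ → Unique-sigma (Unique-range (suc s) n) λ {m} _ →
        Unique-sigma (Unique-satisfying _) λ _ → Unique-satisfying _))
    disjoint
    where
    disjoint : ∀ {x} → ¬ (x ∈ map inj₁ sameCycle × x ∈ map inj₂ differentCycles)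
    disjoint (p , q) with ∈-map⁻ inj₁ p | ∈-map⁻ inj₂ q
    ... | _ , _ , refl | _ , _ , ()

  parameters-valid : ∀ {x} → x ∈ parameters → Valid x
  parameters-valid x∈ with ∈-++⁻ (map inj₁ sameCycle) x∈
  ... | inj₁ x∈₁ with ∈-map⁻ inj₁ x∈₁
  ... | (ℓ , z , k , j , i) , p , refl with ∈-sigma⁻ (range 3 n) _ p
  ... | _ , p′ with ∈-sigma⁻ (minima β ℓ) _ p′
  ... | z∈ , p″ with ∈-sigma⁻ (upTo ℓ) _ p″
  ... | k∈ , p‴ with ∈-sigma⁻ (upTo k) upTo p‴ | ∈-minima⁻ β ℓ z∈
  ... | j∈ , i∈ | period , min = period , (λ {t} → min {t}) , ∈-upTo⁻ i∈ , ∈-upTo⁻ j∈ , ∈-upTo⁻ k∈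
  parameters-valid x∈ | inj₂ x∈₂ with ∈-map⁻ inj₂ x∈₂
  ... | (s , m , b , a) , p , refl with ∈-sigma⁻ (range 1 n) _ p
  ... | _ , p′ with ∈-sigma⁻ (range (suc s) n) _ p′
  ... | m∈ , p″ with ∈-sigma⁻ (points β s) _ p″
  ... | b∈ , a∈ = ∈-range⁻ (suc s) m∈ , ∈-points⁻ β s b∈ , ∈-points⁻ β m a∈

  valid-parameters : Injective f → ∀ {x} → Valid x → x ∈ parameters
  valid-parameters inj {inj₁ (ℓ , z , k , j , i)} (period , min , i<j , j<k , k<ℓ) =
    ∈-++⁺ˡ (∈-map⁺ inj₁ (∈-sigma⁺ (∈-range⁺ 3≤ℓ (period-≤ inj period)) (∈-sigma⁺ (∈-minima⁺ β period min)
      (∈-sigma⁺ (∈-upTo⁺ k<ℓ) (∈-sigma⁺ {f = upTo} (∈-upTo⁺ j<k) (∈-upTo⁺ i<j))))))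
    where
    3≤ℓ : 3 ≤ ℓ
    3≤ℓ = ≤-trans (s≤s (≤-trans (s≤s (≤-<-trans z≤n i<j)) j<k)) k<ℓ
  valid-parameters inj {inj₂ (s , m , b , a)} (s<m , period-b , period-a) =
    ∈-++⁺ʳ (map inj₁ sameCycle) (∈-map⁺ inj₂ (∈-sigma⁺ (∈-range⁺ (IsPeriod.positive period-b) (period-≤ inj period-b))
      (∈-sigma⁺ (∈-range⁺ s<m (period-≤ inj period-a)) (∈-sigma⁺ (∈-points⁺ β period-b) (∈-points⁺ β period-a)))))

  length-parameters : Injective f → length parameters ≡ formulaFactor n (cycleCount β)
  length-parameters inj = trans (length-++ (map inj₁ sameCycle)) (cong₂ _+_
    (trans (length-map inj₁ sameCycle) (length-sigma-range 3 n _ _ λ ℓ →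
      trans (length-sigma-const (minima β ℓ) (triples ℓ)) (cong₂ _*_ (length-minima β ℓ) (length-triples ℓ))))
    (trans (length-map inj₂ differentCycles) (length-sigma-range 1 n _ _ λ s → length-sigma-range (suc s) n _ _ λ m →
      trans (length-sigma-const (points β s) (points β m))
        (trans (cong₂ _*_ (length-points β inj s) (length-points β inj m))
          (rearrange (cycleCount β s) s (cycleCount β m) m)))))
    where
    open +-*-Solver
    rearrange : ∀ c s d m → c * s * (d * m) ≡ s * m * c * d
    rearrange = solve 4 (λ c s d m → c :* s :* (d :* m) := s :* m :* c :* d) refl

  moved₁ moved₂ moved₃ : Parameter n → Fin n
  moved₁ (inj₁ (ℓ , z , k , j , i)) = pow f i z
  moved₁ (inj₂ (s , m , b , a))     = a
  moved₂ (inj₁ (ℓ , z , k , j , i)) = pow f j z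
  moved₂ (inj₂ (s , m , b , a))     = b
  moved₃ (inj₁ (ℓ , z , k , j , i)) = pow f k z
  moved₃ (inj₂ (s , m , b , a))     = pow f s a

  twisted : Parameter n → Fin n → Fin n
  twisted x = twist f (moved₁ x) (moved₂ x) (moved₃ x)

  conjugator : Parameter n → Fin n → Fin n
  conjugator x@(inj₁ _) = glue f (twisted x) (moved₁ x) (moved₁ x) id
  conjugator x@(inj₂ _) = glue f (twisted x) (moved₁ x) (moved₁ x) (glue f (twisted x) (moved₂ x) (moved₃ x) id)

  module _ (inj : Injective f) where

    solution : ∀ x → Valid x → Solution f (moved₁ x) (moved₂ x) (moved₃ x) (conjugator x)
    solution (inj₁ _) (period , _ , i<j , j<k , k<ℓ) = oneCycle-solution inj period i<j j<k k<ℓ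
    solution (inj₂ _) (s<m , period-b , period-a)    = twoCycles-solution inj s<m period-b period-a

    Rotated : (x y : Parameter n) → Set
    Rotated x y = let a = moved₁ x ; b = moved₂ x ; c = moved₃ x ; abc = (moved₁ y , moved₂ y , moved₃ y) in
      (a , b , c) ≡ abc ⊎ (b , c , a) ≡ abc ⊎ (c , a , b) ≡ abc

    -- A 3-cycle has three spellings, and `Valid` admits one: increasing indices counted from the
    -- least element, or the point of the shorter cycle in the middle. The two kinds cannot meet,
    -- since only in the first do all three points have the same period.
    rotated⇒≡ : ∀ x y → Valid x → Valid y → Rotated x y → x ≡ y
    rotated⇒≡ (inj₁ (ℓ , z , k , j , i)) (inj₁ (ℓ′ , z′ , k′ , j′ , i′)) (period , min , i<j , j<k , k<ℓ)
      (period′ , min′ , i<j′ , j<k′ , k<ℓ′) rot = same (start rot)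
      where
      start : Rotated (inj₁ (ℓ , z , k , j , i)) (inj₁ (ℓ′ , z′ , k′ , j′ , i′)) → Orbit f z (pow f i′ z′)
      start (inj₁ eq)        = i , ,-injectiveˡ eq
      start (inj₂ (inj₁ eq)) = j , ,-injectiveˡ eq
      start (inj₂ (inj₂ eq)) = k , ,-injectiveˡ eq
      j<ℓ = <-trans j<k k<ℓ
      i<ℓ = <-trans i<j j<ℓ
      same : Orbit f z (pow f i′ z′) → _
      same z⇝ with orbit-trans z⇝ (orbit-sym period′ (i′ , refl))
      ... | z⇝z′ with period-unique (orbit-period inj period z⇝z′) period′
      ... | refl with minimum-unique period period′ min min′ z⇝z′
      ... | refl = positions rot
        where
        j<ℓ′ = <-trans j<k′ k<ℓ′
        i<ℓ′ = <-trans i<j′ j<ℓ′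
        index : ∀ {s t} → s < ℓ → t < ℓ → pow f s z ≡ pow f t z → s ≡ t
        index = period-injective inj period
        positions : _ → _
        positions (inj₁ eq)
          with index i<ℓ i<ℓ′ (,-injectiveˡ eq) | index j<ℓ j<ℓ′ (,-injectiveˡ (,-injectiveʳ eq))
             | index k<ℓ k<ℓ′ (,-injectiveʳ (,-injectiveʳ eq))
        ... | refl | refl | refl = refl
        positions (inj₂ (inj₁ eq))
          with index k<ℓ j<ℓ′ (,-injectiveˡ (,-injectiveʳ eq)) | index i<ℓ k<ℓ′ (,-injectiveʳ (,-injectiveʳ eq))
        ... | refl | refl = contradiction j<k′ (<-asym (<-trans i<j j<k))
        positions (inj₂ (inj₂ eq))
          with index k<ℓ i<ℓ′ (,-injectiveˡ eq) | index i<ℓ j<ℓ′ (,-injectiveˡ (,-injectiveʳ eq))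
        ... | refl | refl = contradiction i<j′ (<-asym (<-trans i<j j<k))
    rotated⇒≡ (inj₁ (ℓ , z , k , j , i)) (inj₂ (s , m , b , a)) (period , _) (s<m , period-b , period-a) rot =
      ⊥-elim (one-period rot)
      where
      impossible : ∀ {s t} → pow f s z ≡ a → pow f t z ≡ b → ⊥
      impossible {s} {t} refl refl = <⇒≢ s<m (trans (period-unique period-b (period-pow inj t period))
        (period-unique (period-pow inj s period) period-a))
      one-period : _ → ⊥
      one-period (inj₁ eq)        = impossible {i} {j} (,-injectiveˡ eq) (,-injectiveˡ (,-injectiveʳ eq))
      one-period (inj₂ (inj₁ eq)) = impossible {j} {k} (,-injectiveˡ eq) (,-injectiveˡ (,-injectiveʳ eq))
      one-period (inj₂ (inj₂ eq)) = impossible {k} {i} (,-injectiveˡ eq) (,-injectiveˡ (,-injectiveʳ eq))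
    rotated⇒≡ x@(inj₂ _) y@(inj₁ _) vx vy rot = sym (rotated⇒≡ y x vy vx (rotated-sym rot))
      where
      rotated-sym : Rotated x y → Rotated y x
      rotated-sym (inj₁ eq)        = inj₁ (sym eq)
      rotated-sym (inj₂ (inj₁ eq)) = inj₂ (inj₂ (cong (λ { (b , c , a) → a , b , c }) (sym eq)))
      rotated-sym (inj₂ (inj₂ eq)) = inj₂ (inj₁ (cong (λ { (c , a , b) → a , b , c }) (sym eq)))
    rotated⇒≡ (inj₂ (s , m , b , a)) (inj₂ (s′ , m′ , b′ , a′)) (s<m , pb , pa) (s<m′ , pb′ , pa′) rot = positions rot
      where
      ¬swapped : m ≡ s′ → s ≡ m′ → ⊥
      ¬swapped refl refl = <-asym s<m s<m′
      positions : _ → _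
      positions (inj₁ eq) with ,-injectiveˡ eq | ,-injectiveˡ (,-injectiveʳ eq)
      ... | refl | refl with period-unique pb pb′ | period-unique pa pa′
      ... | refl | refl = refl
      positions (inj₂ (inj₁ eq)) = ⊥-elim (¬swapped
        (period-unique (period-pow inj s pa) (subst (IsPeriod f s′) (sym (,-injectiveˡ (,-injectiveʳ eq))) pb′))
        (period-unique pb (subst (IsPeriod f m′) (sym (,-injectiveˡ eq)) pa′)))
      positions (inj₂ (inj₂ eq)) = ⊥-elim (¬swapped
        (period-unique pa (subst (IsPeriod f s′) (sym (,-injectiveˡ (,-injectiveʳ eq))) pb′))
        (period-unique pb (subst (IsPeriod f m′) (sym (,-injectiveʳ (,-injectiveʳ eq))) (period-pow inj s′ pa′))))

    parameter-exists : ∀ {S γ a b c} → Conjugate f γ → Twist S f γ a b c →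
      ∃ λ x → Valid x × Twist S f γ (moved₁ x) (moved₂ x) (moved₃ x)
    parameter-exists {S} {γ} κ w =
      [ from-shape w , [ from-shape (rotate w) , from-shape (rotate (rotate w)) ] ] (twist-shape inj κ w)
      where
      from-shape : ∀ {a b c} → Twist S f γ a b c → Shape f S a b c →
        ∃ λ x → Valid x × Twist S f γ (moved₁ x) (moved₂ x) (moved₃ x)
      from-shape {a} w (oneCycle ra rb rc) with period-exists inj a
      ... | ℓ , p with minimum-exists inj p
      ... | z , period , min , z⇝a with increasing-positions inj period w ra rb rc z⇝a
      ... | i , j , k , i<j , j<k , k<ℓ , w′ =
        inj₁ (ℓ , z , k , j , i) , (period , (λ {t} → min {t}) , i<j , j<k , k<ℓ) , w′
      from-shape {a} {b} w (twoCycles {s} ra rb) with period-exists inj a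
      ... | m , p = inj₂ (s , m , b , a) , (s<m , period-b , p) ,
                    subst (Twist S f γ a b) (sym (Return.arrives ra)) w
        where
        period-b : IsPeriod f s b
        period-b = isPeriod (Return.positive rb) (Return.arrives rb)
          λ 0<t t<s eq → Return.avoids rb 0<t t<s (subst S (sym eq) (Twist.Sb w))
        -- The arc of `a` cannot run past `a`, and it ends at `c`, which is not `a`.
        s<m : s < m
        s<m with <-cmp s m
        ... | tri< s<m _ _  = s<m
        ... | tri≈ _ refl _ = contradiction (trans (sym (Return.arrives ra)) (IsPeriod.returns p)) (Twist.c≢a w)
        ... | tri> _ _ m<s  = contradiction (subst S (sym (IsPeriod.returns p)) (Twist.Sa w))
                                (Return.avoids ra (IsPeriod.positive p) m<s)

-- The Hamming and commutation conditions in terms of twists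

lookup-injective : {σ τ : Map n} → (∀ a → lookup σ a ≡ lookup τ a) → σ ≡ τ
lookup-injective {σ = σ} {τ} eq = trans (sym (tabulate∘lookup σ)) (trans (tabulate-cong eq) (tabulate∘lookup τ))

length-three : {xs : List A} → length xs ≡ 3 → Unique xs →
  ∃ λ u → ∃ λ v → ∃ λ w → u ≢ v × v ≢ w × w ≢ u × xs ≡ u ∷ v ∷ w ∷ []
length-three {xs = u ∷ v ∷ w ∷ []} refl ((u≢v ∷ u≢w ∷ []) ∷ (v≢w ∷ []) ∷ _) =
  u , v , w , u≢v , v≢w , u≢w ∘ sym , refl

module _ (β : Map n) (σ : Map n) where

  private
    f = lookup β
    α = lookup σ

    left : ∀ a → lookup (σ ∘ₚ β) a ≡ α (f a)
    left = lookup∘tabulate _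

    right : ∀ a → lookup (β ∘ₚ σ) a ≡ f (α a)
    right = lookup∘tabulate _

    differ : Fin n → Bool
    differ a = not (lookup (σ ∘ₚ β) a == lookup (β ∘ₚ σ) a)

    differ⁺ : ∀ {a} → α (f a) ≢ f (α a) → a ∈ satisfying differ
    differ⁺ {a} ne = ∈-satisfying⁺ differ (T-not⁺ λ t →
      ne (trans (sym (left a)) (trans (==⁻ (lookup (σ ∘ₚ β) a) (lookup (β ∘ₚ σ) a) t) (right a))))

    differ⁻ : ∀ {a} → a ∈ satisfying differ → α (f a) ≢ f (α a)
    differ⁻ {a} a∈ eq = T-not⁻ {lookup (σ ∘ₚ β) a == lookup (β ∘ₚ σ) a} (∈-satisfying⁻ differ a∈)
      (==⁺ (trans (left a) (trans eq (sym (right a)))))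

  commute⁺ : (∀ a → α (f a) ≡ f (α a)) → T (allF λ a → lookup (σ ∘ₚ β) a == lookup (β ∘ₚ σ) a)
  commute⁺ comm = T-allF⁺ _ λ a → ==⁺ (trans (left a) (trans (comm a) (sym (right a))))

  commute⁻ : T (allF λ a → lookup (σ ∘ₚ β) a == lookup (β ∘ₚ σ) a) → ∀ a → α (f a) ≡ f (α a)
  commute⁻ t a = trans (sym (left a)) (trans (==⁻ _ _ (T-allF⁻ _ t a)) (right a))

  -- `α` carries the points where the two products differ onto the points where `γ` and `β` differ,
  -- which are `a`, `b`, `c`.
  twist⇒H≡3 : Injective f → Injective α → ∀ {S γ a b c} → Twist S f γ a b c →
    (∀ x → α (f x) ≡ γ (α x)) → T (H (σ ∘ₚ β) (β ∘ₚ σ) ≡ᵇ 3)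
  twist⇒H≡3 f-inj α-inj {S} {γ} {a} {b} {c} w comm = ≡⇒≡ᵇ _ 3 (trans (countF≡length differ)
    (bijection⇒length≡ α (Unique-satisfying differ)
      ((a≢b ∷ c≢a ∘ sym ∷ []) ∷ (b≢c ∷ []) ∷ [] ∷ []) (λ _ _ → α-inj) into onto))
    where
    open Twist w
    listed : ∀ {y} → S y → y ∈ a ∷ b ∷ c ∷ []
    listed Sy with cases Sy
    ... | inj₁ refl        = here refl
    ... | inj₂ (inj₁ refl) = there (here refl)
    ... | inj₂ (inj₂ refl) = there (there (here refl))
    listed⁻ : ∀ {y} → y ∈ a ∷ b ∷ c ∷ [] → S y
    listed⁻ (here refl)                 = Sa
    listed⁻ (there (here refl))         = Sb
    listed⁻ (there (there (here refl))) = Sc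
    into : ∀ {x} → x ∈ satisfying differ → α x ∈ a ∷ b ∷ c ∷ []
    into {x} x∈ = listed (decidable-stable (twist-dec w (α x)) λ ¬Sx →
      differ⁻ x∈ (trans (comm x) (off ¬Sx)))
    onto : ∀ {y} → y ∈ a ∷ b ∷ c ∷ [] → ∃ λ x → x ∈ satisfying differ × y ≡ α x
    onto {y} y∈ with injective⇒surjective α α-inj y
    ... | x , refl = x , differ⁺ (λ eq → twist-moves f-inj w (listed⁻ y∈) (trans (sym (comm x)) eq)) , refl

  H≡3⇒twist : Injective f → Injective α → T (H (σ ∘ₚ β) (β ∘ₚ σ) ≡ᵇ 3) →
    ∃ λ γ → (∀ x → α (f x) ≡ γ (α x)) × ∃ λ S → ∃ λ a → ∃ λ b → ∃ λ c → Twist {Fin n} S f γ a b c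
  H≡3⇒twist f-inj α-inj t
    with length-three (trans (sym (countF≡length differ)) (≡ᵇ⇒≡ _ 3 t)) (Unique-satisfying differ)
  ... | u , v , w , u≢v , v≢w , w≢u , list = γ , comm , OneOf (α u) (α v) (α w) , α u , found
    where
    inv = λ y → proj₁ (injective⇒surjective α α-inj y)
    α-inv = λ y → proj₂ (injective⇒surjective α α-inj y)
    γ : Fin n → Fin n
    γ y = α (f (inv y))
    comm : ∀ x → α (f x) ≡ γ (α x)
    comm x = cong (α ∘ f) (α-inj (sym (α-inv (α x))))
    γ-inj : Injective γ
    γ-inj {x} {y} eq = trans (sym (α-inv x)) (trans (cong α (f-inj (α-inj eq))) (α-inv y))
    moved-point : ∀ {x} → x ∈ u ∷ v ∷ w ∷ [] → γ (α x) ≢ f (α x)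
    moved-point {x} x∈ eq = differ⁻ (subst (x ∈_) (sym list) x∈) (trans (comm x) eq)
    moved : ∀ {y} → OneOf (α u) (α v) (α w) y → γ y ≢ f y
    moved (inj₁ refl)        = moved-point (here refl)
    moved (inj₂ (inj₁ refl)) = moved-point (there (here refl))
    moved (inj₂ (inj₂ refl)) = moved-point (there (there (here refl)))
    listed : ∀ {x} → x ∈ u ∷ v ∷ w ∷ [] → OneOf (α u) (α v) (α w) (α x)
    listed (here refl)                 = inj₁ refl
    listed (there (here refl))         = inj₂ (inj₁ refl)
    listed (there (there (here refl))) = inj₂ (inj₂ refl)
    off : ∀ {y} → ¬ OneOf (α u) (α v) (α w) y → γ y ≡ f y
    off {y} y∉ = decidable-stable (γ y ≟ f y) λ ne → y∉ (subst (OneOf (α u) (α v) (α w)) (α-inv y)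
      (listed (subst (inv y ∈_) list (differ⁺ λ eq → ne (trans eq (cong f (α-inv y)))))))
    found : ∃ λ b → ∃ λ c → Twist (OneOf (α u) (α v) (α w)) f γ (α u) b c
    found with twist-exists f-inj γ-inj (u≢v ∘ α-inj) (v≢w ∘ α-inj) (w≢u ∘ α-inj) moved off
    ... | inj₁ tw = α v , α w , tw
    ... | inj₂ tw = α w , α v , tw

-- The bijection with pairs of a parameter and a centralizing permutation

theorem5 : (n : ℕ) (β : Map n) → T (isPerm β) →
    c3 n β ≡ formulaFactor n (cycleCount β) * centralizerSize n β
theorem5 n β perm
  with countPerms-enumerates {n} (λ σ → H (σ ∘ₚ β) (β ∘ₚ σ) ≡ᵇ 3)
     | countPerms-enumerates {n} (λ σ → allF λ a → lookup (σ ∘ₚ β) a == lookup (β ∘ₚ σ) a)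
... | near , c3≡ , near-enum | centralizer , size≡ , centralizer-enum = begin
    c3 n β                                                ≡⟨ c3≡ ⟩
    length near                                           ≡⟨ pairs≡near ⟨
    length pairs                                          ≡⟨ length-sigma-const (parameters β) centralizer ⟩
    length (parameters β) * length centralizer            ≡⟨ cong₂ _*_ (length-parameters β inj) (sym size≡) ⟩
    formulaFactor n (cycleCount β) * centralizerSize n β  ∎
  where
  open ≡-Reasoning
  f = lookup β

  inj : Injective f
  inj = isPerm⁻ β perm

  pairs = sigma (parameters β) λ _ → centralizer

  combine : Parameter n × Map n → Map n
  combine (x , κ) = Vec.tabulate λ a → conjugator β x (lookup κ a)

  lookup-combine : ∀ x κ a → lookup (combine (x , κ)) a ≡ conjugator β x (lookup κ a)
  lookup-combine x κ = lookup∘tabulate _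

  record Pair (x : Parameter n) (κ : Map n) : Set where
    field
      valid : Valid β x
      κ-injective : Injective (lookup κ)
      κ-commutes : ∀ a → lookup κ (f a) ≡ f (lookup κ a)
    open Solution (solution β inj x valid) public
    combined-injective : Injective (lookup (combine (x , κ)))
    combined-injective {a} {b} eq = κ-injective (injective
      (trans (sym (lookup-combine x κ a)) (trans eq (lookup-combine x κ b))))
    combined-intertwines : ∀ a → lookup (combine (x , κ)) (f a) ≡ twisted β x (lookup (combine (x , κ)) a)
    combined-intertwines a = begin
      lookup (combine (x , κ)) (f a)             ≡⟨ lookup-combine x κ (f a) ⟩
      conjugator β x (lookup κ (f a))            ≡⟨ cong (conjugator β x) (κ-commutes a) ⟩
      conjugator β x (f (lookup κ a))            ≡⟨ intertwines (lookup κ a) ⟩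
      twisted β x (conjugator β x (lookup κ a))  ≡⟨ cong (twisted β x) (lookup-combine x κ a) ⟨
      twisted β x (lookup (combine (x , κ)) a)   ∎

  pair : ∀ {x κ} → (x , κ) ∈ pairs → Pair x κ
  pair {x} {κ} x∈ with ∈-sigma⁻ (parameters β) _ x∈
  ... | x∈params , κ∈ with Enumerates.sound centralizer-enum κ∈
  ... | κ-inj , comm = record
    { valid = parameters-valid β x∈params ; κ-injective = κ-inj ; κ-commutes = commute⁻ β κ comm }

  combine-near : ∀ {xκ} → xκ ∈ pairs → combine xκ ∈ near
  combine-near {x , κ} x∈ = Enumerates.complete near-enum
    ( (λ {a} {b} → combined-injective {a} {b})
    , twist⇒H≡3 β (combine (x , κ)) inj combined-injective isTwist combined-intertwines )
    where open Pair (pair x∈)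

  combine-injective : ∀ {xκ yλ} → xκ ∈ pairs → yλ ∈ pairs → combine xκ ≡ combine yλ → xκ ≡ yλ
  combine-injective {x , κ} {y , κ′} x∈ y∈ eq
    with rotated⇒≡ β inj x y P.valid Q.valid (twist-unique inj twisted≡ P.isTwist Q.isTwist)
    where
    module P = Pair (pair x∈)
    module Q = Pair (pair y∈)
    -- The twist is the conjugate of `β` by the combined map, so equal combined maps have equal
    -- twists, hence equal parameters. Cancelling the conjugator then identifies the centralizing
    -- factors.
    twisted≡ : ∀ a → twisted β x a ≡ twisted β y a
    twisted≡ a with injective⇒surjective (lookup (combine (x , κ))) P.combined-injective a
    ... | b , refl = begin
      twisted β x (lookup (combine (x , κ)) b)   ≡⟨ P.combined-intertwines b ⟨
      lookup (combine (x , κ)) (f b)             ≡⟨ cong (λ σ → lookup σ (f b)) eq ⟩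
      lookup (combine (y , κ′)) (f b)            ≡⟨ Q.combined-intertwines b ⟩
      twisted β y (lookup (combine (y , κ′)) b)  ≡⟨ cong (λ σ → twisted β y (lookup σ b)) eq ⟨
      twisted β y (lookup (combine (x , κ)) b)   ∎
  ... | refl = cong (x ,_) (lookup-injective λ a → Pair.injective (pair x∈)
    (trans (sym (lookup-combine x κ a)) (trans (cong (λ σ → lookup σ a) eq) (lookup-combine x κ′ a))))

  near-combine : ∀ {σ} → σ ∈ near → ∃ λ xκ → xκ ∈ pairs × σ ≡ combine xκ
  near-combine {σ} σ∈ with Enumerates.sound near-enum σ∈
  ... | α-inj , H≡3 with H≡3⇒twist β σ inj α-inj H≡3
  ... | γ , comm , S , a , b , c , w
    with parameter-exists β inj (record { conj = lookup σ ; conj-injective = α-inj ; intertwines = comm }) w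
  ... | x , valid , w′ = (x , κ) , ∈-sigma⁺ (valid-parameters β inj {x} valid) κ∈ , lookup-injective σ≡
    where
    open Solution (solution β inj x valid)
    τ = conjugator β x
    τ⁻¹ = λ y → proj₁ (injective⇒surjective τ injective y)
    τ-τ⁻¹ = λ y → proj₂ (injective⇒surjective τ injective y)
    -- `τ` and `σ` conjugate `β` to the same permutation, so `τ` inverse after `σ` commutes with
    -- `β`.
    κ : Map n
    κ = Vec.tabulate λ a → τ⁻¹ (lookup σ a)
    τ-κ : ∀ a → τ (lookup κ a) ≡ lookup σ a
    τ-κ a = trans (cong τ (lookup∘tabulate _ a)) (τ-τ⁻¹ (lookup σ a))
    σ≡ : ∀ a → lookup σ a ≡ lookup (combine (x , κ)) a
    σ≡ a = trans (sym (τ-κ a)) (sym (lookup-combine x κ a))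
    κ-injective : Injective (lookup κ)
    κ-injective {a} {b} eq = α-inj (trans (sym (τ-κ a)) (trans (cong τ eq) (τ-κ b)))
    κ-commutes : ∀ a → lookup κ (f a) ≡ f (lookup κ a)
    κ-commutes a = injective (begin
      τ (lookup κ (f a))            ≡⟨ τ-κ (f a) ⟩
      lookup σ (f a)                ≡⟨ comm a ⟩
      γ (lookup σ a)                ≡⟨ twist-determined w′ isTwist (lookup σ a) ⟩
      twisted β x (lookup σ a)      ≡⟨ cong (twisted β x) (τ-κ a) ⟨
      twisted β x (τ (lookup κ a))  ≡⟨ intertwines (lookup κ a) ⟨
      τ (f (lookup κ a))            ∎)
    κ∈ : κ ∈ centralizer
    κ∈ = Enumerates.complete centralizer-enum ((λ {a} {b} → κ-injective {a} {b}) , commute⁺ β κ κ-commutes)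

  pairs≡near : length pairs ≡ length near
  pairs≡near = bijection⇒length≡ combine
    (Unique-sigma (Unique-parameters β) λ _ → Enumerates.unique centralizer-enum)
    (Enumerates.unique near-enum) combine-injective combine-near near-combine
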